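{- Let $a\ge 1$ and let $\vec p=(p_1,\dots,p_a)$ be a probability vector. Let $E_{n,a,\vec p}$ denote expectation with respect to the biased $a$-shuffle measure $P_{n,a;\vec p}$ on $S_n$, and let $Inv(\pi)$ be the number of inversions of $\pi$. Then, as formal power series in $u$, $$\sum_{n=0}^{\infty}\frac{u^n}{[n]!}\,E_{n,a,\vec p}\big[q^{Inv}\big]=\prod_{i=1}^a\left[\sum_{j=0}^\infty\frac{(up_i)^j}{[j]!}\right]=\prod_{i=1}^a\prod_{j=0}^\infty\frac{1}{1-up_i(1-q)q^j},$$ where the first equality holds with coefficients that are rational functions in the indeterminate $q$, and the second equality holds when $|q|<1$ (the infinite product being the coefficientwise limit, as power series in $u$, of its finite partial products).
   Context: Probability vector: real $p_i\ge 0$ with $\sum_{i=1}^a p_i=1$. The $n=0$ term on the left equals $1$. $[n]!=\prod_{i=0}^{n-1}(1+q+\cdots+q^i)$, with $[0]!=1$. $Inv(\pi)$ is the number of pairs $i<j$ with $\pi(i)>\pi(j)$. Descents: $\pi\in S_n$ has a descent at position $i$ ($1\le i\le n-1$) if $\pi(i)>\pi(i+1)$; by convention every $\pi\in S_n$ also has a descent at position $n$. The descent set of $\pi$ is the set of positions at which it has a descent. The measure $P_{n,a;\vec p}$ on $S_n$ (biased riffle shuffle): first choose $(b_1,\dots,b_a)$, $b_i\ge 0$, $b_1+\cdots+b_a=n$, with probability $\binom{n}{b_1\cdots b_a}\prod_{i=1}^a p_i^{b_i}$; then choose uniformly one of the $\binom{n}{b_1\cdots b_a}$ permutations $\pi\in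 S_n$ such that the descent set of $\pi^{ -1}$ is contained in $\{b_1,b_1+b_2,\dots,b_1+\cdots+b_a=n\}$. -}

module Defs where

open import Algebra.Apartness.Bundles using (HeytingField)
open import Algebra.Bundles using (CommutativeRing)
open import Algebra.Bundles.Raw using (RawRing)
open import Algebra.Definitions using (Invertible)
import Algebra.Apartness.Properties.HeytingCommutativeRing as HeytingProperties
import Algebra.Definitions.RawSemiring as RawSemiringDefinitions
open import Data.Bool.Base using (if_then_else_)
open import Data.Empty using (⊥-elim)
open import Data.Fin.Base as Fin using (Fin; zero; suc; toℕ)
open import Data.Fin.Permutation as Perm using (Permutation′; _⟨$⟩ʳ_; _⟨$⟩ˡ_)
import Data.Fin.Properties as Fin
open import Data.List.Base as List using (List; []; _∷_; allFin; upTo)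
open import Data.List.Membership.Propositional.Properties using (∈-allFin)
import Data.List.Properties as List
open import Data.List.Relation.Unary.Any using (Any; here)
import Data.List.Relation.Unary.Any.Properties as Any
open import Data.Nat.Base as ℕ using (ℕ; zero; suc; _∸_; _!)
import Data.Nat.Properties as ℕ
import Data.Nat.DivMod as ℕ
open import Data.Product.Base using (∃-syntax; _×_; _,_; proj₁; proj₂)
open import Data.Sum.Base using (_⊎_; inj₁; inj₂)
open import Data.Vec.Base as Vec using (Vec; []; _∷_)
open import Data.Vec.Functional using (Vector)
open import Function.Bundles using (_⇔_; Equivalence)
open import Level using (_⊔_) renaming (suc to ℓsuc)
open import Relation.Binary.Core using (Rel)
open import Relation.Binary.Definitions using (_Respects₂_; Transitive; Irreflexive)
open import Relation.Binary.PropositionalEquality.Core as ≡ using (_≡_)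
import Relation.Binary.Reasoning.Setoid as SetoidReasoning
open import Relation.Nullary using (¬_; Dec; does; _×-dec_; _⊎-dec_; _→-dec_)
open import Relation.Unary using (Pred; Decidable)

-- A Cauchy complete Archimedean ordered field.  Classically ℝ is the
-- only one up to isomorphism.  The axioms are the constructive ones
-- (apartness and a cotransitive order instead of decidable equality and
-- trichotomy), which Bishop's reals satisfy too.

record RealField c ℓ₁ ℓ₂ ℓ₃ : Set (ℓsuc (c ⊔ ℓ₁ ⊔ ℓ₂ ⊔ ℓ₃)) where
  field
    heytingField : HeytingField c ℓ₁ ℓ₂

  open HeytingField heytingField public

  infix 4 _<_ _≤_
  field
    _<_       : Rel Carrier ℓ₃
    <-irrefl  : Irreflexive _≈_ _<_
    <-trans   : Transitive _<_
    <-resp-≈  : _<_ Respects₂ _≈_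
    <-cotrans : ∀ {x y} → x < y → ∀ z → x < z ⊎ z < y
    #⇔<⊎>     : ∀ {x y} → (x # y) ⇔ (x < y ⊎ y < x)
    0<1       : 0# < 1#
    +-mono-<  : ∀ {x y} z → x < y → x + z < y + z
    *-pos     : ∀ {x y} → 0# < x → 0# < y → 0# < x * y

  _≤_ : Rel Carrier ℓ₃
  x ≤ y = ¬ (y < x)

  commutativeRing : CommutativeRing c ℓ₁
  commutativeRing = record { isCommutativeRing = isCommutativeRing }

  open CommutativeRing commutativeRing public using (rawRing)

  open RawSemiringDefinitions (RawRing.rawSemiring rawRing) public
    using (sum; product; _^_) renaming (_×_ to _·_)

  Cauchy : (ℕ → Carrier) → Set (c ⊔ ℓ₃)
  Cauchy s = ∀ ε → 0# < ε →
    ∃[ N ] (∀ m n → N ℕ.≤ m → N ℕ.≤ n → s m - s n < ε)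

  Limit : (ℕ → Carrier) → Carrier → Set (c ⊔ ℓ₃)
  Limit s x = ∀ ε → 0# < ε →
    ∃[ N ] (∀ n → N ℕ.≤ n → (s n - x < ε) × (x - s n < ε))

  field
    archimedean : ∀ x → ∃[ n ] (x < n · 1#)
    complete    : ∀ s → Cauchy s → ∃[ x ] Limit s x

-- insert zero j π maps 0 to j and keeps the relative order of the
-- remaining values of π.

permutations : ∀ n → List (Permutation′ n)
permutations zero    = Perm.id ∷ []
permutations (suc n) =
  List.cartesianProductWith (Perm.insert zero) (allFin (suc n)) (permutations n)

-- Since there are n ! entries and every permutation occurs, each occurs
-- exactly once (up to pointwise equality).

length-permutations : ∀ n → List.length (permutations n) ≡ n !
length-permutations zero    = ≡.refl
length-permutations (suc n) = ≡.trans
  (length-cartesianProductWith (Perm.insert zero) (allFin (suc n)) (permutations n))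
  (≡.cong₂ ℕ._*_ (List.length-tabulate {n = suc n} (λ i → i)) (length-permutations n))
  where
  length-cartesianProductWith :
    ∀ {A B C : Set} (f : A → B → C) xs ys →
    List.length (List.cartesianProductWith f xs ys) ≡ List.length xs ℕ.* List.length ys
  length-cartesianProductWith f []       ys = ≡.refl
  length-cartesianProductWith f (x ∷ xs) ys = ≡.trans
    (List.length-++ (List.map (f x) ys))
    (≡.cong₂ ℕ._+_ (List.length-map (f x) ys) (length-cartesianProductWith f xs ys))

permutations-complete : ∀ {n} (π : Permutation′ n) → Any (Perm._≈ π) (permutations n)
permutations-complete {zero}  π = here λ ()
permutations-complete {suc n} π =
  Any.cartesianProductWith⁺ (Perm.insert zero) combine
    (∈-allFin (π ⟨$⟩ʳ zero)) (permutations-complete (Perm.remove zero π))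
  where
  insert-cong : ∀ {σ ρ : Permutation′ n} j → σ Perm.≈ ρ →
                Perm.insert zero j σ Perm.≈ Perm.insert zero j ρ
  insert-cong j σ≈ρ zero    = ≡.refl
  insert-cong j σ≈ρ (suc k) = ≡.cong (Fin.punchIn j) (σ≈ρ k)

  combine : ∀ {j σ} → π ⟨$⟩ʳ zero ≡ j → σ Perm.≈ Perm.remove zero π →
            Perm.insert zero j σ Perm.≈ π
  combine ≡.refl σ≈ k =
    ≡.trans (insert-cong (π ⟨$⟩ʳ zero) σ≈ k) (Perm.insert-remove zero π k)

Inv : ∀ {n} → Permutation′ n → ℕ
Inv {n} π = List.length (List.filter inversion? (List.cartesianProduct (allFin n) (allFin n)))
  where
  inversion? : Decidable {A = Fin n × Fin n}
    (λ (i , j) → i Fin.< j × π ⟨$⟩ʳ j Fin.< π ⟨$⟩ʳ i)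
  inversion? (i , j) = (i Fin.<? j) ×-dec (π ⟨$⟩ʳ j Fin.<? π ⟨$⟩ʳ i)

-- An index i : Fin n stands for the position suc (toℕ i) ∈ {1, …, n}.

HasDescentAt : ∀ {n} → Permutation′ n → Fin n → Set
HasDescentAt {n} π i =
  suc (toℕ i) ≡ n ⊎ ∃[ j ] (toℕ j ≡ suc (toℕ i) × π ⟨$⟩ʳ j Fin.< π ⟨$⟩ʳ i)

-- prefixSum (b₁ ∷ … ∷ bₐ ∷ []) k = b₁ + ⋯ + b₍ₖ₊₁₎, as k counts from 0.

prefixSum : ∀ {a} → Vec ℕ a → Fin a → ℕ
prefixSum (b ∷ bs) zero    = b
prefixSum (b ∷ bs) (suc k) = b ℕ.+ prefixSum bs k

DescentsWithin : ∀ {n a} → Vec ℕ a → Permutation′ n → Set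
DescentsWithin b π = ∀ i → HasDescentAt π i → ∃[ k ] (suc (toℕ i) ≡ prefixSum b k)

descentsWithin? : ∀ {n a} (b : Vec ℕ a) (π : Permutation′ n) → Dec (DescentsWithin b π)
descentsWithin? {n} b π = Fin.all? λ i →
  ((suc (toℕ i) ℕ.≟ n) ⊎-dec
    Fin.any? λ j → (toℕ j ℕ.≟ suc (toℕ i)) ×-dec (π ⟨$⟩ʳ j Fin.<? π ⟨$⟩ʳ i))
  →-dec Fin.any? λ k → suc (toℕ i) ℕ.≟ prefixSum b k

weakCompositions : (n a : ℕ) → List (Vec ℕ a)
weakCompositions n       (suc a) =
  List.concatMap (λ b → List.map (b ∷_) (weakCompositions (n ∸ b) a)) (upTo (suc n))
weakCompositions zero    zero    = [] ∷ []
weakCompositions (suc n) zero    = []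

∏! : ∀ {a} → Vec ℕ a → ℕ
∏! []       = 1
∏! (b ∷ bs) = b ! ℕ.* ∏! bs

∏!≢0 : ∀ {a} (b : Vec ℕ a) → ℕ.NonZero (∏! b)
∏!≢0 []       = _
∏!≢0 (b ∷ bs) = ℕ.m*n≢0 (b !) (∏! bs) {{b ℕ.!≢0}} {{∏!≢0 bs}}

multinomial : ∀ {a} → Vec ℕ a → ℕ
multinomial b = ((Vec.sum b !) ℕ./ ∏! b) {{∏!≢0 b}}

module _ {c ℓ} (K : RawRing c ℓ) where
  open RawRing K
  open RawSemiringDefinitions rawSemiring using (sum)

  PowerSeries : Set c
  PowerSeries = ℕ → Carrier

  powerSeries : RawRing c ℓ
  powerSeries = record
    { Carrier = PowerSeries
    ; _≈_     = λ f g → ∀ n → f n ≈ g n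
    ; _+_     = λ f g n → f n + g n
    ; _*_     = λ f g n → sum {suc n} λ k → f (toℕ k) * g (n ∸ toℕ k)
    ; -_      = λ f n → - f n
    ; 0#      = λ _ → 0#
    ; 1#      = λ { zero → 1# ; (suc _) → 0# }
    }

  -- The series c · u in the variable u.

  _·u : Carrier → PowerSeries
  (c ·u) 1 = c
  (c ·u) _ = 0#

module _ {c ℓ₁ ℓ₂ ℓ₃} (R : RealField c ℓ₁ ℓ₂ ℓ₃) where

  private
    module R = RealField R
    open R using (Carrier; _≈_; _#_; _+_; _*_; -_; _-_; 0#; 1#; _<_; _≤_)

    module H = HeytingProperties (HeytingField.heytingCommutativeRing R.heytingField)

  -- The polynomial x₀ + x₁ q + x₂ q² + ⋯ is the list x₀ ∷ x₁ ∷ x₂ ∷ ⋯.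
  -- Trailing zeros are allowed and are ignored by the equality.

  Polynomial : Set c
  Polynomial = List Carrier

  coefficient : Polynomial → ℕ → Carrier
  coefficient []      _       = 0#
  coefficient (x ∷ f) zero    = x
  coefficient (x ∷ f) (suc n) = coefficient f n

  infix 4 _≈ₚ_
  _≈ₚ_ : Rel Polynomial ℓ₁
  f ≈ₚ g = ∀ n → coefficient f n ≈ coefficient g n

  infixl 6 _+ₚ_
  _+ₚ_ : Polynomial → Polynomial → Polynomial
  []      +ₚ g       = g
  (x ∷ f) +ₚ []      = x ∷ f
  (x ∷ f) +ₚ (y ∷ g) = x + y ∷ (f +ₚ g)

  scale : Carrier → Polynomial → Polynomial
  scale x = List.map (x *_)

  infixl 7 _*ₚ_
  _*ₚ_ : Polynomial → Polynomial → Polynomial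
  []      *ₚ g = []
  (x ∷ f) *ₚ g = scale x g +ₚ (0# ∷ (f *ₚ g))

  NonZeroₚ : Polynomial → Set ℓ₂
  NonZeroₚ f = ∃[ n ] (coefficient f n # 0#)

  private
    open CommutativeRing R.commutativeRing
      using (setoid; +-congˡ; +-congʳ; *-congˡ; *-comm; +-assoc;
             +-comm; +-identityˡ; +-identityʳ; zeroˡ; zeroʳ; refl; sym; trans; -‿inverseʳ)

    0¬#0 : ¬ (0# # 0#)
    0¬#0 = R.#-irrefl refl

    cancel-#0 : ∀ {x y z} → x ≈ y + z → z # 0# → x # 0# ⊎ y # 0#
    cancel-#0 {x} {y} {z} x≈y+z z#0 with R.#-cotrans z#0 x
    ... | inj₂ x#0 = inj₁ x#0
    ... | inj₁ z#x with R.#⇒invertible (R.#-sym z#x)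
    ...   | t , t*[x-z]≈1 , _ = inj₂ (H.invertibleˡ⇒# (t , trans (*-congˡ y-0≈x-z) t*[x-z]≈1))
      where
      open SetoidReasoning setoid
      y-0≈x-z : y - 0# ≈ x - z
      y-0≈x-z = begin
        y - 0#         ≈⟨ H.x-0≈x y ⟩
        y              ≈⟨ +-identityʳ y ⟨
        y + 0#         ≈⟨ +-congˡ (-‿inverseʳ z) ⟨
        y + (z - z)    ≈⟨ +-assoc y z (- z) ⟨
        (y + z) - z    ≈⟨ +-congʳ x≈y+z ⟨
        x - z          ∎

    *-#0ˡ : ∀ {x y} → x * y # 0# → x # 0#
    *-#0ˡ {x} {y} xy#0 with R.#⇒invertible xy#0
    ... | z , z*[xy-0]≈1 , _ = H.invertibleˡ⇒# (z * y , eq)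
      where
      open SetoidReasoning setoid
      eq : z * y * (x - 0#) ≈ 1#
      eq = begin
        z * y * (x - 0#)    ≈⟨ *-congˡ (H.x-0≈x x) ⟩
        z * y * x           ≈⟨ R.*-assoc z y x ⟩
        z * (y * x)         ≈⟨ *-congˡ (*-comm y x) ⟩
        z * (x * y)         ≈⟨ *-congˡ (H.x-0≈x (x * y)) ⟨
        z * (x * y - 0#)    ≈⟨ z*[xy-0]≈1 ⟩
        1#                  ∎

    coefficient-+ : ∀ f g n → coefficient (f +ₚ g) n ≈ coefficient f n + coefficient g n
    coefficient-+ []      g       n       = sym (+-identityˡ _)
    coefficient-+ (x ∷ f) []      n       = sym (+-identityʳ _)
    coefficient-+ (x ∷ f) (y ∷ g) zero    = refl
    coefficient-+ (x ∷ f) (y ∷ g) (suc n) = coefficient-+ f g n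

    coefficient-scale : ∀ x f n → coefficient (scale x f) n ≈ x * coefficient f n
    coefficient-scale x []      n       = sym (zeroʳ x)
    coefficient-scale x (y ∷ f) zero    = refl
    coefficient-scale x (y ∷ f) (suc n) = coefficient-scale x f n

    coefficient-* : ∀ x f g n → coefficient ((x ∷ f) *ₚ g) n ≈
                    x * coefficient g n + coefficient (0# ∷ (f *ₚ g)) n
    coefficient-* x f g n =
      trans (coefficient-+ (scale x g) _ n) (+-congʳ (coefficient-scale x g n))

    coefficient-*-0 : ∀ f g → coefficient (f *ₚ g) 0 ≈ coefficient f 0 * coefficient g 0
    coefficient-*-0 []      g = sym (zeroˡ _)
    coefficient-*-0 (x ∷ f) g = trans (coefficient-* x f g 0) (+-identityʳ _)

    coefficient-*-∷ : ∀ f y g n → coefficient (f *ₚ (y ∷ g)) (suc n) ≈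
                      coefficient f (suc n) * y + coefficient (f *ₚ g) n
    coefficient-*-∷ []      y g n = sym (trans (+-identityʳ _) (zeroˡ y))
    coefficient-*-∷ (x ∷ f) y g n = begin
      coefficient ((x ∷ f) *ₚ (y ∷ g)) (suc n)
        ≈⟨ coefficient-* x f (y ∷ g) (suc n) ⟩
      x * coefficient g n + coefficient (f *ₚ (y ∷ g)) n
        ≈⟨ +-congˡ (step n) ⟩
      x * coefficient g n + (coefficient f n * y + coefficient (0# ∷ (f *ₚ g)) n)
        ≈⟨ +-assoc _ _ _ ⟨
      x * coefficient g n + coefficient f n * y + coefficient (0# ∷ (f *ₚ g)) n
        ≈⟨ +-congʳ (+-comm _ _) ⟩
      coefficient f n * y + x * coefficient g n + coefficient (0# ∷ (f *ₚ g)) n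
        ≈⟨ +-assoc _ _ _ ⟩
      coefficient f n * y + (x * coefficient g n + coefficient (0# ∷ (f *ₚ g)) n)
        ≈⟨ +-congˡ (coefficient-* x f g n) ⟨
      coefficient f n * y + coefficient ((x ∷ f) *ₚ g) n
        ∎
      where
      open SetoidReasoning setoid
      step : ∀ m → coefficient (f *ₚ (y ∷ g)) m ≈
             coefficient f m * y + coefficient (0# ∷ (f *ₚ g)) m
      step zero    = trans (coefficient-*-0 f (y ∷ g)) (sym (+-identityʳ _))
      step (suc m) = coefficient-*-∷ f y g m

    *ₚ-nonZero′ : ∀ f g i j → coefficient f i # 0# → coefficient g j # 0# →
                  NonZeroₚ (f *ₚ g)
    *ₚ-nonZero′ []      g       i       j       fᵢ#0 gⱼ#0 = ⊥-elim (0¬#0 fᵢ#0)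
    *ₚ-nonZero′ (x ∷ f) []      i       j       fᵢ#0 gⱼ#0 = ⊥-elim (0¬#0 gⱼ#0)
    *ₚ-nonZero′ (x ∷ f) (y ∷ g) zero    zero    x#0  y#0  =
      0 , H.#-congʳ (sym (coefficient-*-0 (x ∷ f) (y ∷ g))) (H.x#0y#0→xy#0 x#0 y#0)
    *ₚ-nonZero′ (x ∷ f) (y ∷ g) zero    (suc j) x#0  gⱼ#0
      with *ₚ-nonZero′ (x ∷ f) g zero j x#0 gⱼ#0
    ... | m , fg#0 with cancel-#0 (coefficient-*-∷ (x ∷ f) y g m) fg#0
    ...   | inj₁ done = suc m , done
    ...   | inj₂ fy#0 =
      *ₚ-nonZero′ (x ∷ f) (y ∷ g) zero zero x#0 (*-#0ˡ (H.#-congʳ (*-comm _ _) fy#0))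
    *ₚ-nonZero′ (x ∷ f) (y ∷ g) (suc i) j       fᵢ#0 gⱼ#0
      with *ₚ-nonZero′ f (y ∷ g) i j fᵢ#0 gⱼ#0
    ... | m , fg#0 with cancel-#0 (coefficient-* x f (y ∷ g) (suc m)) fg#0
    ...   | inj₁ done = suc m , done
    ...   | inj₂ xg#0 = *ₚ-nonZero′ (x ∷ f) (y ∷ g) zero j (*-#0ˡ xg#0) gⱼ#0

  *ₚ-nonZero : ∀ f g → NonZeroₚ f → NonZeroₚ g → NonZeroₚ (f *ₚ g)
  *ₚ-nonZero f g (i , fᵢ#0) (j , gⱼ#0) = *ₚ-nonZero′ f g i j fᵢ#0 gⱼ#0

  record RationalFunction : Set (c ⊔ ℓ₂) where
    constructor _/_[_]
    field
      numerator   : Polynomial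
      denominator : Polynomial
      nonZero     : NonZeroₚ denominator

  polynomial : Polynomial → RationalFunction
  polynomial f = f / 1# ∷ [] [ 0 , H.1#0 ]

  ℝ⟨q⟩ : RawRing (c ⊔ ℓ₂) ℓ₁
  ℝ⟨q⟩ = record
    { Carrier = RationalFunction
    ; _≈_     = λ { (f / d [ _ ]) (g / e [ _ ]) → f *ₚ e ≈ₚ g *ₚ d }
    ; _+_     = λ { (f / d [ d≠0 ]) (g / e [ e≠0 ]) →
                    (f *ₚ e +ₚ g *ₚ d) / d *ₚ e [ *ₚ-nonZero d e d≠0 e≠0 ] }
    ; _*_     = λ { (f / d [ d≠0 ]) (g / e [ e≠0 ]) →
                    (f *ₚ g) / d *ₚ e [ *ₚ-nonZero d e d≠0 e≠0 ] }
    ; -_      = λ { (f / d [ d≠0 ]) → List.map -_ f / d [ d≠0 ] }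
    ; 0#      = polynomial []
    ; 1#      = polynomial (1# ∷ [])
    }

  constant : Carrier → RationalFunction
  constant x = polynomial (x ∷ [])

  indeterminate : RationalFunction
  indeterminate = polynomial (0# ∷ 1# ∷ [])

  ℂ : RawRing c ℓ₁
  ℂ = record
    { Carrier = Carrier × Carrier
    ; _≈_     = λ { (x , y) (x′ , y′) → x ≈ x′ × y ≈ y′ }
    ; _+_     = λ { (x , y) (x′ , y′) → x + x′ , y + y′ }
    ; _*_     = λ { (x , y) (x′ , y′) → x * x′ - y * y′ , x * y′ + y * x′ }
    ; -_      = λ { (x , y) → - x , - y }
    ; 0#      = 0# , 0#
    ; 1#      = 1# , 0#
    }

  real : Carrier → RawRing.Carrier ℂ
  real x = x , 0#

  -- Comparing squares avoids the square root in ∣ z ∣.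

  ∣_∣<_ : RawRing.Carrier ℂ → Carrier → Set ℓ₃
  ∣ (x , y) ∣< r = 0# < r × x * x + y * y < r * r

  _⟶_ : (ℕ → RawRing.Carrier ℂ) → RawRing.Carrier ℂ → Set (c ⊔ ℓ₃)
  s ⟶ z = ∀ ε → 0# < ε → ∃[ N ] (∀ n → N ℕ.≤ n → ∣ RawRing._+_ ℂ (s n) (RawRing.-_ ℂ z) ∣< ε)

  CoefficientwiseLimit : (ℕ → PowerSeries ℂ) → PowerSeries ℂ → Set (c ⊔ ℓ₃)
  CoefficientwiseLimit F G = ∀ n → (λ J → F J n) ⟶ G n

  IsProbabilityVector : ∀ {a} → Vector Carrier a → Set (ℓ₁ ⊔ ℓ₃)
  IsProbabilityVector p = (∀ i → 0# ≤ p i) × R.sum p ≈ 1#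

  private
    0<1+n : ∀ n → 0# < suc n R.· 1#
    0<1+n zero    = proj₁ R.<-resp-≈ (sym (+-identityʳ 1#)) R.0<1
    0<1+n (suc n) = R.<-trans R.0<1
      (proj₂ R.<-resp-≈ (+-identityˡ 1#)
        (proj₁ R.<-resp-≈ (+-comm _ 1#) (R.+-mono-< 1# (0<1+n n))))

    1+n#0 : ∀ n → suc n R.· 1# # 0#
    1+n#0 n = Equivalence.from R.#⇔<⊎> (inj₂ (0<1+n n))

  -- 1/ 0 is never used: in uniform below it would be the weight of an
  -- element of an empty list.

  1/_ : ℕ → Carrier
  1/ zero  = 0#
  1/ suc n = proj₁ (R.#⇒invertible (1+n#0 n))

  uniform : ∀ {ℓ ℓ′} {A : Set ℓ} {P : Pred A ℓ′} → Decidable P → List A → A → Carrier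
  uniform P? xs x = if does (P? x) then 1/ List.length (List.filter P? xs) else 0#

  cutProbability : ∀ {a} → Vector Carrier a → Vec ℕ a → Carrier
  cutProbability p b = (multinomial b R.· 1#) * R.product (λ i → p i R.^ Vec.lookup b i)

  shuffleProbability : ∀ {n a} → Vector Carrier a → Permutation′ n → Carrier
  shuffleProbability {n} {a} p π = List.foldr _+_ 0# (List.map weight (weakCompositions n a))
    where
    weight : Vec ℕ a → Carrier
    weight b = cutProbability p b *
      uniform (λ σ → descentsWithin? b (Perm.flip σ)) (permutations n) π

  -- K is ℝ(q) or ℂ, with ι the embedding of ℝ.

  module Generating {k ℓ} (K : RawRing k ℓ)
                    (ι : Carrier → RawRing.Carrier K) (q : RawRing.Carrier K) where
    private
      module K = RawRing K

    open RawRing (powerSeries K) public using ()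
      renaming (_≈_ to _≈ₛ_; _+_ to _+ₛ_; _*_ to _*ₛ_; -_ to -ₛ_; 1# to 1ₛ)
    open RawSemiringDefinitions (RawRing.rawSemiring (powerSeries K)) public using ()
      renaming (product to ∏ₛ)
    open RawSemiringDefinitions K.rawSemiring using (_^_)
      renaming (sum to ∑; product to ∏)

    [_]! : ℕ → K.Carrier
    [ n ]! = ∏ {n} λ i → ∑ {suc (toℕ i)} λ k → q ^ toℕ k

    expectation : ∀ {a} n → Vector Carrier a → (Permutation′ n → K.Carrier) → K.Carrier
    expectation n p X = List.foldr K._+_ K.0#
      (List.map (λ π → ι (shuffleProbability p π) K.* X π) (permutations n))

    FactorialsInvertible : Set (k ⊔ ℓ)
    FactorialsInvertible = ∀ n → Invertible K._≈_ K.1# K._*_ [ n ]!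

    module _ (1/! : FactorialsInvertible) where

      -- ∑ₙ uⁿ / [n]! · E[q^Inv]
      inversionSeries : ∀ {a} → Vector Carrier a → PowerSeries K
      inversionSeries p n = proj₁ (1/! n) K.* expectation n p (λ π → q ^ Inv π)

      -- ∑ⱼ (u x)ʲ / [j]!
      qExponential : Carrier → PowerSeries K
      qExponential x j = ι x ^ j K.* proj₁ (1/! j)

    -- 1 - u x (1 - q) qʲ
    factor : Carrier → ℕ → PowerSeries K
    factor x j = 1ₛ +ₛ (-ₛ (_·u K (ι x K.* (K.1# K.+ K.- q) K.* q ^ j)))

    FactorsInvertible : ∀ {a} → Vector Carrier a → Set (k ⊔ ℓ)
    FactorsInvertible p = ∀ i j → Invertible _≈ₛ_ 1ₛ _*ₛ_ (factor (p i) j)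

    -- ∏_{j<J} 1 / (1 - u pᵢ (1 - q) qʲ)
    partialProduct : ∀ {a} {p : Vector Carrier a} → FactorsInvertible p →
                     Fin a → ℕ → PowerSeries K
    partialProduct 1/factor i J = ∏ₛ {J} λ j → proj₁ (1/factor i (toℕ j))

module Submission where

open import Defs
open import Algebra.Bundles.Raw using (RawRing)
open import Data.Nat.Base using (ℕ; _≤_)
open import Data.Product.Base using (_×_; Σ-syntax)
open import Data.Vec.Functional using (Vector)
open import Algebra.Bundles using (AbelianGroup; CommutativeRing; CommutativeSemiring)
open import Algebra.Definitions using (Invertible)
open import Algebra.Morphism.Structures using (module SemiringMorphisms)
open import Algebra.Solver.Ring.AlmostCommutativeRing using (fromCommutativeRing; _-Raw-AlmostCommutative⟶_)
import Algebra.Apartness.Properties.HeytingCommutativeRing as HeytingProperties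
import Algebra.Morphism.Construct.Composition as Composition
open import Data.Bool.Base using (Bool; true; false; if_then_else_; _∧_)
open import Data.Fin.Base as Fin using (Fin; zero; suc; toℕ; punchIn; punchOut; _↑ˡ_; _↑ʳ_)
open import Data.Fin.Permutation as Perm using (Permutation′; _⟨$⟩ʳ_; _⟨$⟩ˡ_)
import Data.Fin.Properties as Fin
open import Data.List.Base as List using (List; []; _∷_; allFin; upTo)
import Data.List.Properties as List
open import Data.List.Relation.Unary.All as All using (All; []; _∷_)
import Data.List.Relation.Unary.All.Properties as All
open import Data.Maybe.Base using (Maybe; just; nothing)
open import Data.Nat.Base as ℕ using (zero; suc; z≤n; s≤s; z<s; s<s; s≤s⁻¹; _∸_; _⊔_; _!)
import Data.Nat.DivMod as ℕ
import Data.Nat.Properties as ℕ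
open import Data.Product.Base using (∃-syntax; _,_; proj₁; proj₂)
open import Data.Sum.Base using (_⊎_; inj₁; inj₂; [_,_]′)
open import Data.Vec.Base as Vec using (Vec; []; _∷_)
open import Function.Base using (_∘_)
open import Function.Bundles using (_⇔_; Equivalence; mk⇔)
open import Level as Level using (Level)
open import Relation.Binary.Definitions using (tri<; tri≈; tri>)
open import Relation.Binary.PropositionalEquality.Core as ≡ using (_≡_)
import Relation.Binary.PropositionalEquality.Properties as ≡
import Relation.Binary.Reasoning.Setoid as SetoidReasoning
open import Relation.Nullary using (¬_; Dec; does; yes; no; contradiction; _×-dec_)
open import Relation.Nullary.Decidable using (does-⇔; dec-true; dec-false)
open import Relation.Unary using (Decidable)

-- Build a permutation from its first value j and the pattern of the other
-- values; this first value creates j inversions.  If the descents of the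
-- inverse are confined to b₁, b₁ + b₂, …, then j is the least value of one of
-- the blocks of lengths bᵢ, and the rest is counted by the composition in which
-- this block is shortened by one.  With [n] = 1 + q + ⋯ + qⁿ⁻¹, the recursion
-- and [b₁ + b₂ + ⋯] = [b₁] + q^b₁ [b₂] + ⋯ give the q-multinomial coefficient
-- as the sum of q^Inv over these permutations, and its case q = 1 is their
-- number.  Hence the conditional expectation of q^Inv given the cut sizes,
-- divided by [n]!, is a term of the Cauchy product of the q-exponentials.
--
-- For the infinite product, the coefficient of uⁿ in ∏_{j<J} 1 / (1 - x (1 - q) qʲ u)
-- is xⁿ / [n]! · (1 - qᴶ) ⋯ (1 - qᴶ⁺ⁿ⁻¹), which tends to xⁿ / [n]! when ∣ q ∣ < 1.

-- A ring solver with integer coefficients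

-- The counting identity is proved multiplied out, as a sum of `q ^ Inv π` times `∏⟨ b ⟩!` equal to
-- `⟨ n ⟩!`, so that it needs only a commutative semiring and applies to ℕ itself. There it shows
-- that the multinomial coefficient is the number of admissible permutations, so it cancels against
-- the uniform weight, and the probability of π becomes a plain sum of monomials in p over the
-- admissible cut sizes. The other obstacle is that equality and order of reals are not decidable.
-- Transitivity for fractions needs cancellation of a polynomial having some coefficient apart from
-- 0, which rests on tightness. Inverses exist only for numbers shown apart from 0: in ℝ(q) the
-- constant coefficient 1 of [n + 1] suffices, and in ℂ the units 1 - qⁿ with n ≥ 1, and with them
-- [n], come from strict bounds on ∣ q ∣². As sizes are compared through squares, convergence is
-- also handled with ∣ z ∣², where the parallelogram law takes the place of the triangle inequality.

-- The integer m - n is the pair (m , n).  The solver compares normal forms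
-- by refl, so the representation must be unique.
reduce : ℕ → ℕ → ℕ × ℕ
reduce (suc m) (suc n) = reduce m n
reduce m       n       = m , n

differences : RawRing _ _
differences = record
  { Carrier = ℕ × ℕ
  ; _≈_     = _≡_
  ; _+_     = λ (m , n) (m′ , n′) → reduce (m ℕ.+ m′) (n ℕ.+ n′)
  ; _*_     = λ (m , n) (m′ , n′) → reduce (m ℕ.* m′ ℕ.+ n ℕ.* n′) (m ℕ.* n′ ℕ.+ n ℕ.* m′)
  ; -_      = λ (m , n) → n , m
  ; 0#      = 0 , 0
  ; 1#      = 1 , 0
  }

-- The solver must compare coefficients in order to cancel terms. Equality in R is not decidable, so
-- the coefficients are integers, mapped into R.
module IntegerSolver {c ℓ} (R : CommutativeRing c ℓ) where
  open CommutativeRing R hiding (zero)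
  open import Algebra.Properties.Semiring.Mult semiring
    using (×-homo-+; ×1-homo-*) renaming (_×_ to _·_)
  open import Algebra.Properties.Ring ring using (-‿distribˡ-*; -‿distribʳ-*; -0#≈0#; -‿involutive)
  open import Algebra.Properties.AbelianGroup +-abelianGroup using (⁻¹-∙-comm)
  open import Algebra.Properties.CommutativeSemigroup +-commutativeSemigroup using (interchange)
  open import Relation.Binary.Reasoning.Setoid setoid

  private
    +-sub : ∀ x y z w → (x + z) - (y + w) ≈ (x - y) + (z - w)
    +-sub x y z w = trans (+-congˡ (sym (⁻¹-∙-comm y w))) (interchange x z (- y) (- w))

    difference : ℕ × ℕ → Carrier
    difference (m , n) = m · 1# - n · 1#

    -- The special cases make the constants 0 and 1 of the solver
    -- definitionally equal to 0# and 1#.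
    ⟦_⟧ : ℕ × ℕ → Carrier
    ⟦ 0 , 0 ⟧ = 0#
    ⟦ 1 , 0 ⟧ = 1#
    ⟦ a     ⟧ = difference a

    ⟦⟧≈ : ∀ a → ⟦ a ⟧ ≈ difference a
    ⟦⟧≈ (0           , 0)     = sym (-‿inverseʳ 0#)
    ⟦⟧≈ (1           , 0)     = sym (trans (+-cong (+-identityʳ 1#) -0#≈0#) (+-identityʳ 1#))
    ⟦⟧≈ (suc (suc m) , 0)     = refl
    ⟦⟧≈ (0           , suc n) = refl
    ⟦⟧≈ (1           , suc n) = refl
    ⟦⟧≈ (suc (suc m) , suc n) = refl

    ⟦reduce⟧ : ∀ m n → ⟦ reduce m n ⟧ ≈ m · 1# - n · 1#
    ⟦reduce⟧ zero    n       = ⟦⟧≈ (zero , n)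
    ⟦reduce⟧ (suc m) zero    = ⟦⟧≈ (suc m , zero)
    ⟦reduce⟧ (suc m) (suc n) = begin
      ⟦ reduce m n ⟧                        ≈⟨ ⟦reduce⟧ m n ⟩
      m · 1# - n · 1#                       ≈⟨ +-identityˡ _ ⟨
      0# + (m · 1# - n · 1#)                ≈⟨ +-congʳ (-‿inverseʳ 1#) ⟨
      (1# - 1#) + (m · 1# - n · 1#)         ≈⟨ +-sub _ _ _ _ ⟨
      suc m · 1# - suc n · 1#               ∎

    *-sub : ∀ x y z w → (x - y) * (z - w) ≈ (x * z + y * w) - (x * w + y * z)
    *-sub x y z w = begin
      (x - y) * (z - w)                              ≈⟨ distribʳ _ _ _ ⟩
      x * (z - w) + - y * (z - w)                    ≈⟨ +-cong (distribˡ _ _ _) (distribˡ _ _ _) ⟩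
      (x * z + x * - w) + (- y * z + - y * - w)      ≈⟨ +-cong (+-congˡ (sym (-‿distribʳ-* x w))) (+-comm _ _) ⟩
      (x * z - x * w) + (- y * - w + - y * z)        ≈⟨ +-congˡ (+-cong
                                                          (trans (sym (-‿distribˡ-* y (- w))) (-‿cong (sym (-‿distribʳ-* y w))))
                                                          (sym (-‿distribˡ-* y z))) ⟩
      (x * z - x * w) + (- - (y * w) - y * z)        ≈⟨ +-congˡ (+-congʳ (-‿involutive (y * w))) ⟩
      (x * z - x * w) + (y * w - y * z)              ≈⟨ +-sub (x * z) (x * w) (y * w) (y * z) ⟨
      (x * z + y * w) - (x * w + y * z)              ∎

    homo-*+* : ∀ k l m n → (k ℕ.* l ℕ.+ m ℕ.* n) · 1# ≈ k · 1# * l · 1# + m · 1# * n · 1#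
    homo-*+* k l m n =
      trans (×-homo-+ 1# (k ℕ.* l) (m ℕ.* n)) (+-cong (×1-homo-* k l) (×1-homo-* m n))

    homomorphism : differences -Raw-AlmostCommutative⟶ fromCommutativeRing R
    homomorphism = record
      { ⟦_⟧    = ⟦_⟧
      ; +-homo = λ a@(m , n) b@(m′ , n′) → begin
          ⟦ reduce (m ℕ.+ m′) (n ℕ.+ n′) ⟧                     ≈⟨ ⟦reduce⟧ (m ℕ.+ m′) (n ℕ.+ n′) ⟩
          (m ℕ.+ m′) · 1# - (n ℕ.+ n′) · 1#                    ≈⟨ +-cong (×-homo-+ 1# m m′) (-‿cong (×-homo-+ 1# n n′)) ⟩
          (m · 1# + m′ · 1#) - (n · 1# + n′ · 1#)              ≈⟨ +-sub _ _ _ _ ⟩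
          difference a + difference b                          ≈⟨ +-cong (⟦⟧≈ a) (⟦⟧≈ b) ⟨
          ⟦ a ⟧ + ⟦ b ⟧                                        ∎
      ; *-homo = λ a@(m , n) b@(m′ , n′) → begin
          ⟦ reduce (m ℕ.* m′ ℕ.+ n ℕ.* n′) (m ℕ.* n′ ℕ.+ n ℕ.* m′) ⟧
            ≈⟨ ⟦reduce⟧ (m ℕ.* m′ ℕ.+ n ℕ.* n′) (m ℕ.* n′ ℕ.+ n ℕ.* m′) ⟩
          (m ℕ.* m′ ℕ.+ n ℕ.* n′) · 1# - (m ℕ.* n′ ℕ.+ n ℕ.* m′) · 1#
            ≈⟨ +-cong (homo-*+* m m′ n n′) (-‿cong (homo-*+* m n′ n m′)) ⟩
          (m · 1# * m′ · 1# + n · 1# * n′ · 1#) - (m · 1# * n′ · 1# + n · 1# * m′ · 1#)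
            ≈⟨ *-sub _ _ _ _ ⟨
          difference a * difference b                          ≈⟨ *-cong (⟦⟧≈ a) (⟦⟧≈ b) ⟨
          ⟦ a ⟧ * ⟦ b ⟧                                        ∎
      ; -‿homo = λ a@(m , n) → begin
          ⟦ n , m ⟧               ≈⟨ ⟦⟧≈ (n , m) ⟩
          n · 1# - m · 1#         ≈⟨ +-comm _ _ ⟩
          - (m · 1#) + n · 1#     ≈⟨ +-congˡ (-‿involutive _) ⟨
          - (m · 1#) - - (n · 1#) ≈⟨ ⁻¹-∙-comm _ _ ⟩
          - difference a          ≈⟨ -‿cong (⟦⟧≈ a) ⟨
          - ⟦ a ⟧                 ∎
      ; 0-homo = refl
      ; 1-homo = refl
      }

    equal? : ∀ a b → Maybe (⟦ a ⟧ ≈ ⟦ b ⟧)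
    equal? (m , n) (m′ , n′) with m ℕ.≟ m′ | n ℕ.≟ n′
    ... | yes ≡.refl | yes ≡.refl = just refl
    ... | _          | _          = nothing

  open import Algebra.Solver.Ring differences (fromCommutativeRing R) homomorphism equal? public
    using (solve; _:=_; _:+_; _:*_; _:-_; :-_; con)
    renaming (Polynomial to Expression)

  𝟘 𝟙 : ∀ {n} → Expression n
  𝟘 = con (0 , 0)
  𝟙 = con (1 , 0)

-- Polynomials and rational functions

module Polynomials {c ℓ₁ ℓ₂ ℓ₃} (R : RealField c ℓ₁ ℓ₂ ℓ₃) where

  private module R where
    open RealField R public using (tight; commutativeRing)
    open CommutativeRing commutativeRing public
    open import Algebra.Properties.Ring ring public using (-0#≈0#)
    open IntegerSolver commutativeRing public

  open R using (Carrier; _≈_; 0#; 1#)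

  private
    coeff : Polynomial R → ℕ → Carrier
    coeff = coefficient R

  infixl 6 _⊕_
  _⊕_ : Polynomial R → Polynomial R → Polynomial R
  _⊕_ = _+ₚ_ R

  infixl 7 _⊗_
  _⊗_ : Polynomial R → Polynomial R → Polynomial R
  _⊗_ = _*ₚ_ R

  ⊖_ : Polynomial R → Polynomial R
  ⊖_ = List.map (λ x → R.- x)

  private
    _•_ : Carrier → Polynomial R → Polynomial R
    _•_ = scale R

  -- _≈ₚ_ as a record, so that Agda can infer f and g from f ≋ g.
  infix 4 _≋_
  record _≋_ (f g : Polynomial R) : Set ℓ₁ where
    constructor coefficientwise
    field
      at : ∀ n → coeff f n ≈ coeff g n
  open _≋_ public

  coefficient-+ : ∀ f g n → coeff (f ⊕ g) n ≈ coeff f n R.+ coeff g n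
  coefficient-+ []      g       n       = R.sym (R.+-identityˡ _)
  coefficient-+ (x ∷ f) []      n       = R.sym (R.+-identityʳ _)
  coefficient-+ (x ∷ f) (y ∷ g) zero    = R.refl
  coefficient-+ (x ∷ f) (y ∷ g) (suc n) = coefficient-+ f g n

  coefficient-scale : ∀ x f n → coeff (x • f) n ≈ x R.* coeff f n
  coefficient-scale x []      n       = R.sym (R.zeroʳ x)
  coefficient-scale x (y ∷ f) zero    = R.refl
  coefficient-scale x (y ∷ f) (suc n) = coefficient-scale x f n

  coefficient-neg : ∀ f n → coeff (⊖ f) n ≈ R.- coeff f n
  coefficient-neg []      n       = R.sym R.-0#≈0#
  coefficient-neg (x ∷ f) zero    = R.refl
  coefficient-neg (x ∷ f) (suc n) = coefficient-neg f n

  private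
    ⊕-cong : ∀ {f f′ g g′} → f ≋ f′ → g ≋ g′ → f ⊕ g ≋ f′ ⊕ g′
    ⊕-cong {f} {f′} {g} {g′} f≋ g≋ .at n = R.trans (coefficient-+ f g n)
      (R.trans (R.+-cong (f≋ .at n) (g≋ .at n)) (R.sym (coefficient-+ f′ g′ n)))

    ⊕-assoc : ∀ f g h → (f ⊕ g) ⊕ h ≋ f ⊕ (g ⊕ h)
    ⊕-assoc f g h .at n = begin
      coeff ((f ⊕ g) ⊕ h) n                  ≈⟨ coefficient-+ (f ⊕ g) h n ⟩
      coeff (f ⊕ g) n R.+ coeff h n          ≈⟨ R.+-congʳ (coefficient-+ f g n) ⟩
      coeff f n R.+ coeff g n R.+ coeff h n  ≈⟨ R.+-assoc _ _ _ ⟩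
      coeff f n R.+ (coeff g n R.+ coeff h n) ≈⟨ R.+-congˡ (coefficient-+ g h n) ⟨
      coeff f n R.+ coeff (g ⊕ h) n          ≈⟨ coefficient-+ f (g ⊕ h) n ⟨
      coeff (f ⊕ (g ⊕ h)) n                  ∎
      where open SetoidReasoning R.setoid

    ⊕-comm : ∀ f g → f ⊕ g ≋ g ⊕ f
    ⊕-comm f g .at n = R.trans (coefficient-+ f g n)
      (R.trans (R.+-comm _ _) (R.sym (coefficient-+ g f n)))

    ⊕-identityʳ : ∀ f → f ⊕ [] ≋ f
    ⊕-identityʳ f .at n = R.trans (coefficient-+ f [] n) (R.+-identityʳ _)

    ⊖-inverseˡ : ∀ f → ⊖ f ⊕ f ≋ []
    ⊖-inverseˡ f .at n = R.trans (coefficient-+ (⊖ f) f n)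
      (R.trans (R.+-congʳ (coefficient-neg f n)) (R.-‿inverseˡ _))

    ⊖-inverseʳ : ∀ f → f ⊕ ⊖ f ≋ []
    ⊖-inverseʳ f .at n = R.trans (⊕-comm f (⊖ f) .at n) (⊖-inverseˡ f .at n)

    ⊖-cong : ∀ {f g} → f ≋ g → ⊖ f ≋ ⊖ g
    ⊖-cong {f} {g} f≋g .at n = R.trans (coefficient-neg f n)
      (R.trans (R.-‿cong (f≋g .at n)) (R.sym (coefficient-neg g n)))

  ⊕-abelianGroup : AbelianGroup c ℓ₁
  ⊕-abelianGroup = record
    { _≈_            = _≋_
    ; _∙_            = _⊕_
    ; ε              = []
    ; _⁻¹            = ⊖_
    ; isAbelianGroup = record
      { isGroup = record
        { isMonoid = record
          { isSemigroup = record
            { isMagma = record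
              { isEquivalence = record
                { refl  = coefficientwise λ _ → R.refl
                ; sym   = λ f≋g → coefficientwise λ n → R.sym (f≋g .at n)
                ; trans = λ f≋g g≋h → coefficientwise λ n → R.trans (f≋g .at n) (g≋h .at n)
                }
              ; ∙-cong = ⊕-cong
              }
            ; assoc = ⊕-assoc
            }
          ; identity = (λ _ → coefficientwise λ _ → R.refl) , ⊕-identityʳ
          }
        ; inverse = ⊖-inverseˡ , ⊖-inverseʳ
        ; ⁻¹-cong = ⊖-cong
        }
      ; comm = ⊕-comm
      }
    }

  ∷-cong : ∀ {x y f g} → x ≈ y → f ≋ g → x ∷ f ≋ y ∷ g
  ∷-cong x≈y f≋g .at zero    = x≈y
  ∷-cong x≈y f≋g .at (suc n) = f≋g .at n

  private
    module P = AbelianGroup ⊕-abelianGroup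
    open import Algebra.Properties.CommutativeSemigroup P.commutativeSemigroup
      using (interchange; x∙yz≈y∙xz)
    open SetoidReasoning P.setoid

    0∷[] : 0# ∷ [] ≋ []
    0∷[] .at zero    = R.refl
    0∷[] .at (suc n) = R.refl

    shift-⊕ : ∀ f g → 0# ∷ (f ⊕ g) ≋ (0# ∷ f) ⊕ (0# ∷ g)
    shift-⊕ f g = ∷-cong (R.sym (R.+-identityʳ 0#)) P.refl

    scale-cong : ∀ {x y f g} → x ≈ y → f ≋ g → x • f ≋ y • g
    scale-cong {x} {y} {f} {g} x≈y f≋g .at n = R.trans (coefficient-scale x f n)
      (R.trans (R.*-cong x≈y (f≋g .at n)) (R.sym (coefficient-scale y g n)))

    scale-⊕ : ∀ x f g → x • (f ⊕ g) ≋ x • f ⊕ x • g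
    scale-⊕ x []      g       = P.refl
    scale-⊕ x (y ∷ f) []      = P.refl
    scale-⊕ x (y ∷ f) (z ∷ g) = ∷-cong (R.distribˡ x y z) (scale-⊕ x f g)

    scale-+ : ∀ x y f → (x R.+ y) • f ≋ x • f ⊕ y • f
    scale-+ x y []      = P.refl
    scale-+ x y (z ∷ f) = ∷-cong (R.distribʳ z x y) (scale-+ x y f)

    scale-* : ∀ x y f → (x R.* y) • f ≋ x • (y • f)
    scale-* x y []      = P.refl
    scale-* x y (z ∷ f) = ∷-cong (R.*-assoc x y z) (scale-* x y f)

    scale-0 : ∀ f → 0# • f ≋ []
    scale-0 f .at n = R.trans (coefficient-scale 0# f n) (R.zeroˡ _)

    scale-1 : ∀ f → 1# • f ≋ f
    scale-1 f .at n = R.trans (coefficient-scale 1# f n) (R.*-identityˡ _)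

    scale-shift : ∀ x f → x • (0# ∷ f) ≋ 0# ∷ x • f
    scale-shift x f = ∷-cong (R.zeroʳ x) P.refl

    ⊗-congˡ : ∀ f {g g′} → g ≋ g′ → f ⊗ g ≋ f ⊗ g′
    ⊗-congˡ []      g≋ = P.refl
    ⊗-congˡ (x ∷ f) g≋ = P.∙-cong (scale-cong R.refl g≋) (∷-cong R.refl (⊗-congˡ f g≋))

    ⊗-zeroʳ : ∀ f → f ⊗ [] ≋ []
    ⊗-zeroʳ []      = P.refl
    ⊗-zeroʳ (x ∷ f) = P.trans (∷-cong R.refl (⊗-zeroʳ f)) 0∷[]

    -- Multiplication recurses on its left factor. This is the mirrored recursion on the right
    -- factor, and commutativity follows by comparing the two.
    ⊗-∷ : ∀ f y g → f ⊗ (y ∷ g) ≋ y • f ⊕ (0# ∷ f ⊗ g)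
    ⊗-∷ []      y g = P.sym 0∷[]
    ⊗-∷ (x ∷ f) y g = ∷-cong (R.+-congʳ (R.*-comm x y)) (begin
      x • g ⊕ f ⊗ (y ∷ g)              ≈⟨ P.∙-congˡ (⊗-∷ f y g) ⟩
      x • g ⊕ (y • f ⊕ (0# ∷ f ⊗ g))   ≈⟨ x∙yz≈y∙xz (x • g) (y • f) (0# ∷ f ⊗ g) ⟩
      y • f ⊕ (x • g ⊕ (0# ∷ f ⊗ g))   ∎)

    ⊗-comm : ∀ f g → f ⊗ g ≋ g ⊗ f
    ⊗-comm []      g = P.sym (⊗-zeroʳ g)
    ⊗-comm (x ∷ f) g = P.trans (P.∙-congˡ (∷-cong R.refl (⊗-comm f g))) (P.sym (⊗-∷ g x f))

    -- Equal polynomials may be lists of different lengths, so induction along f does not follow f′.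
    -- Commutativity moves the change of the left factor to the right, where it is harmless.
    ⊗-cong : ∀ {f f′ g g′} → f ≋ f′ → g ≋ g′ → f ⊗ g ≋ f′ ⊗ g′
    ⊗-cong {f} {f′} {g} {g′} f≋ g≋ = begin
      f ⊗ g    ≈⟨ ⊗-congˡ f g≋ ⟩
      f ⊗ g′   ≈⟨ ⊗-comm f g′ ⟩
      g′ ⊗ f   ≈⟨ ⊗-congˡ g′ f≋ ⟩
      g′ ⊗ f′  ≈⟨ ⊗-comm g′ f′ ⟩
      f′ ⊗ g′  ∎

    ⊗-distribˡ : ∀ f g h → f ⊗ (g ⊕ h) ≋ f ⊗ g ⊕ f ⊗ h
    ⊗-distribˡ []      g h = P.refl
    ⊗-distribˡ (x ∷ f) g h = begin
      x • (g ⊕ h) ⊕ (0# ∷ f ⊗ (g ⊕ h))                   ≈⟨ P.∙-cong (scale-⊕ x g h) (∷-cong R.refl (⊗-distribˡ f g h)) ⟩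
      (x • g ⊕ x • h) ⊕ (0# ∷ (f ⊗ g ⊕ f ⊗ h))           ≈⟨ P.∙-congˡ (shift-⊕ (f ⊗ g) (f ⊗ h)) ⟩
      (x • g ⊕ x • h) ⊕ ((0# ∷ f ⊗ g) ⊕ (0# ∷ f ⊗ h))    ≈⟨ interchange (x • g) (x • h) (0# ∷ f ⊗ g) (0# ∷ f ⊗ h) ⟩
      (x • g ⊕ (0# ∷ f ⊗ g)) ⊕ (x • h ⊕ (0# ∷ f ⊗ h))    ∎

    ⊗-distribʳ : ∀ f g h → (g ⊕ h) ⊗ f ≋ g ⊗ f ⊕ h ⊗ f
    ⊗-distribʳ f g h = P.trans (⊗-comm (g ⊕ h) f)
      (P.trans (⊗-distribˡ f g h) (P.∙-cong (⊗-comm f g) (⊗-comm f h)))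

    scale-⊗ : ∀ x f g → (x • f) ⊗ g ≋ x • (f ⊗ g)
    scale-⊗ x []      g = P.refl
    scale-⊗ x (y ∷ f) g = begin
      (x R.* y) • g ⊕ (0# ∷ (x • f) ⊗ g)     ≈⟨ P.∙-cong (scale-* x y g) (∷-cong R.refl (scale-⊗ x f g)) ⟩
      x • (y • g) ⊕ (0# ∷ x • (f ⊗ g))       ≈⟨ P.∙-congˡ (scale-shift x (f ⊗ g)) ⟨
      x • (y • g) ⊕ x • (0# ∷ f ⊗ g)         ≈⟨ scale-⊕ x (y • g) (0# ∷ f ⊗ g) ⟨
      x • (y • g ⊕ (0# ∷ f ⊗ g))             ∎

  shift-⊗ : ∀ f g → (0# ∷ f) ⊗ g ≋ 0# ∷ f ⊗ g
  shift-⊗ f g = P.trans (P.∙-congʳ (scale-0 g)) (P.identityˡ _)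

  private
    ⊗-assoc : ∀ f g h → (f ⊗ g) ⊗ h ≋ f ⊗ (g ⊗ h)
    ⊗-assoc []      g h = P.refl
    ⊗-assoc (x ∷ f) g h = begin
      (x • g ⊕ (0# ∷ f ⊗ g)) ⊗ h           ≈⟨ ⊗-distribʳ h (x • g) (0# ∷ f ⊗ g) ⟩
      (x • g) ⊗ h ⊕ (0# ∷ f ⊗ g) ⊗ h       ≈⟨ P.∙-cong (scale-⊗ x g h) (shift-⊗ (f ⊗ g) h) ⟩
      x • (g ⊗ h) ⊕ (0# ∷ (f ⊗ g) ⊗ h)     ≈⟨ P.∙-congˡ (∷-cong R.refl (⊗-assoc f g h)) ⟩
      x • (g ⊗ h) ⊕ (0# ∷ f ⊗ (g ⊗ h))     ∎

    constant-⊗ : ∀ x f → (x ∷ []) ⊗ f ≋ x • f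
    constant-⊗ x f = P.trans (P.∙-congˡ 0∷[]) (P.identityʳ (x • f))

    ⊗-identityˡ : ∀ f → (1# ∷ []) ⊗ f ≋ f
    ⊗-identityˡ f = P.trans (constant-⊗ 1# f) (scale-1 f)

  polynomialRing : CommutativeRing c ℓ₁
  polynomialRing = record
    { _≈_ = _≋_
    ; _+_ = _⊕_
    ; _*_ = _⊗_
    ; -_  = ⊖_
    ; 0#  = []
    ; 1#  = 1# ∷ []
    ; isCommutativeRing = record
      { isRing = record
        { +-isAbelianGroup = P.isAbelianGroup
        ; *-cong           = ⊗-cong
        ; *-assoc          = ⊗-assoc
        ; *-identity       = ⊗-identityˡ , λ f → P.trans (⊗-comm f _) (⊗-identityˡ f)
        ; distrib          = ⊗-distribˡ , ⊗-distribʳ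
        }
      ; *-comm = ⊗-comm
      }
    }

  private
    module PR = CommutativeRing polynomialRing
    open import Algebra.Properties.Ring PR.ring using (x≈y⇒x∙y⁻¹≈ε; x∙y⁻¹≈ε⇒x≈y; -‿distribˡ-*)

    -- By tightness it is enough to refute that a coefficient of f is apart from 0. If one were,
    -- `*ₚ-nonZero` would give a coefficient of f ⊗ h apart from 0.
    ⊗-zero-divisor : ∀ f h → NonZeroₚ R h → f ⊗ h ≋ [] → f ≋ []
    ⊗-zero-divisor f h (j , hⱼ#0) fh≋0 .at i = proj₁ (R.tight _ _) λ fᵢ#0 →
      let (n , fhₙ#0) = *ₚ-nonZero R f h (i , fᵢ#0) (j , hⱼ#0) in
      proj₂ (R.tight _ _) (fh≋0 .at n) fhₙ#0

  ⊗-cancelʳ : ∀ {f g} h → NonZeroₚ R h → f ⊗ h ≋ g ⊗ h → f ≋ g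
  ⊗-cancelʳ {f} {g} h h≠0 fh≋gh = x∙y⁻¹≈ε⇒x≈y f g (⊗-zero-divisor (f ⊕ ⊖ g) h h≠0 (begin
    (f ⊕ ⊖ g) ⊗ h       ≈⟨ ⊗-distribʳ h f (⊖ g) ⟩
    f ⊗ h ⊕ ⊖ g ⊗ h     ≈⟨ P.∙-congˡ (-‿distribˡ-* g h) ⟨
    f ⊗ h ⊕ ⊖ (g ⊗ h)   ≈⟨ x≈y⇒x∙y⁻¹≈ε fh≋gh ⟩
    []                  ∎))

module RationalFunctions {c ℓ₁ ℓ₂ ℓ₃} (R : RealField c ℓ₁ ℓ₂ ℓ₃) where
  open Polynomials R
  private
    open module P = CommutativeRing polynomialRing using (_-_)
    open IntegerSolver polynomialRing
    module Q = RawRing (ℝ⟨q⟩ R)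

    infix 4 _≃_
    -- `Q._≈_` unfolds to an equality of products, from which the two fractions cannot be inferred.
    -- The record keeps them in the type.
    record _≃_ (x y : RationalFunction R) : Set ℓ₁ where
      constructor crossMultiplied
      field
        crossMultiply : RationalFunction.numerator x ⊗ RationalFunction.denominator y ≋
                        RationalFunction.numerator y ⊗ RationalFunction.denominator x

    ≃⇒≈ : ∀ {x y} → x ≃ y → x Q.≈ y
    ≃⇒≈ (crossMultiplied eq) = eq .at

    ≈⇒≃ : ∀ {x y} → x Q.≈ y → x ≃ y
    ≈⇒≃ eq = crossMultiplied (coefficientwise eq)

    open SetoidReasoning P.setoid

    -- Both cross-multiplied equations combine only after multiplication by the middle denominator
    -- e, which is then cancelled.
    ≃-trans : ∀ {x y z} → x ≃ y → y ≃ z → x ≃ z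
    ≃-trans {f / d [ _ ]} {g / e [ e≠0 ]} {h / k [ _ ]} (crossMultiplied fe≋gd) (crossMultiplied gk≋he) =
      crossMultiplied (⊗-cancelʳ e e≠0 (begin
        (f ⊗ k) ⊗ e   ≈⟨ solve 3 (λ f k e → (f :* k) :* e := (f :* e) :* k) P.refl f k e ⟩
        (f ⊗ e) ⊗ k   ≈⟨ P.*-congʳ fe≋gd ⟩
        (g ⊗ d) ⊗ k   ≈⟨ solve 3 (λ g d k → (g :* d) :* k := (g :* k) :* d) P.refl g d k ⟩
        (g ⊗ k) ⊗ d   ≈⟨ P.*-congʳ gk≋he ⟩
        (h ⊗ e) ⊗ d   ≈⟨ solve 3 (λ h e d → (h :* e) :* d := (h :* d) :* e) P.refl h e d ⟩
        (h ⊗ d) ⊗ e   ∎))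

    +-cong : ∀ {x x′ y y′} → x ≃ x′ → y ≃ y′ → x Q.+ y ≃ x′ Q.+ y′
    +-cong {f / d [ _ ]} {f′ / d′ [ _ ]} {g / e [ _ ]} {g′ / e′ [ _ ]}
           (crossMultiplied fd′≋f′d) (crossMultiplied ge′≋g′e) = crossMultiplied (begin
      (f ⊗ e ⊕ g ⊗ d) ⊗ (d′ ⊗ e′)
        ≈⟨ solve 6 (λ f d g e d′ e′ → (f :* e :+ g :* d) :* (d′ :* e′)
             := (f :* d′) :* (e :* e′) :+ (g :* e′) :* (d :* d′)) P.refl f d g e d′ e′ ⟩
      (f ⊗ d′) ⊗ (e ⊗ e′) ⊕ (g ⊗ e′) ⊗ (d ⊗ d′)
        ≈⟨ P.+-cong (P.*-congʳ fd′≋f′d) (P.*-congʳ ge′≋g′e) ⟩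
      (f′ ⊗ d) ⊗ (e ⊗ e′) ⊕ (g′ ⊗ e) ⊗ (d ⊗ d′)
        ≈⟨ solve 6 (λ f′ d g′ e d′ e′ → (f′ :* d) :* (e :* e′) :+ (g′ :* e) :* (d :* d′)
             := (f′ :* e′ :+ g′ :* d′) :* (d :* e)) P.refl f′ d g′ e d′ e′ ⟩
      (f′ ⊗ e′ ⊕ g′ ⊗ d′) ⊗ (d ⊗ e) ∎)

    *-cong : ∀ {x x′ y y′} → x ≃ x′ → y ≃ y′ → x Q.* y ≃ x′ Q.* y′
    *-cong {f / d [ _ ]} {f′ / d′ [ _ ]} {g / e [ _ ]} {g′ / e′ [ _ ]}
           (crossMultiplied fd′≋f′d) (crossMultiplied ge′≋g′e) = crossMultiplied (begin
      (f ⊗ g) ⊗ (d′ ⊗ e′)  ≈⟨ interchange f g d′ e′ ⟩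
      (f ⊗ d′) ⊗ (g ⊗ e′)  ≈⟨ P.*-cong fd′≋f′d ge′≋g′e ⟩
      (f′ ⊗ d) ⊗ (g′ ⊗ e)  ≈⟨ interchange f′ d g′ e ⟩
      (f′ ⊗ g′) ⊗ (d ⊗ e)  ∎)
      where open import Algebra.Properties.CommutativeSemigroup P.*-commutativeSemigroup using (interchange)

    -‿cong : ∀ {x y} → x ≃ y → Q.- x ≃ Q.- y
    -‿cong {f / d [ _ ]} {g / e [ _ ]} (crossMultiplied fe≋gd) = crossMultiplied (begin
      ⊖ f ⊗ e      ≈⟨ -‿distribˡ-* f e ⟨
      ⊖ (f ⊗ e)    ≈⟨ P.-‿cong fe≋gd ⟩
      ⊖ (g ⊗ d)    ≈⟨ -‿distribˡ-* g d ⟩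
      ⊖ g ⊗ d      ∎)
      where open import Algebra.Properties.Ring P.ring using (-‿distribˡ-*)

    +-comm : ∀ x y → x Q.+ y ≃ y Q.+ x
    +-comm (f / d [ _ ]) (g / e [ _ ]) = crossMultiplied (solve 4
      (λ f d g e → (f :* e :+ g :* d) :* (e :* d) := (g :* d :+ f :* e) :* (d :* e)) P.refl f d g e)

    *-comm : ∀ x y → x Q.* y ≃ y Q.* x
    *-comm (f / d [ _ ]) (g / e [ _ ]) = crossMultiplied (P.*-cong (P.*-comm f g) (P.*-comm e d))

    +-identityˡ : ∀ x → Q.0# Q.+ x ≃ x
    +-identityˡ (f / d [ _ ]) = crossMultiplied (solve 2
      (λ f d → (𝟘 :* d :+ f :* 𝟙) :* d := f :* (𝟙 :* d)) P.refl f d)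

    *-identityˡ : ∀ x → Q.1# Q.* x ≃ x
    *-identityˡ (f / d [ _ ]) = crossMultiplied (solve 2
      (λ f d → (𝟙 :* f) :* d := f :* (𝟙 :* d)) P.refl f d)

    +-assoc : ∀ x y z → (x Q.+ y) Q.+ z ≃ x Q.+ (y Q.+ z)
    +-assoc (f / d [ _ ]) (g / e [ _ ]) (h / k [ _ ]) = crossMultiplied (solve 6
      (λ f d g e h k → ((f :* e :+ g :* d) :* k :+ h :* (d :* e)) :* (d :* (e :* k))
        := (f :* (e :* k) :+ (g :* k :+ h :* e) :* d) :* ((d :* e) :* k)) P.refl f d g e h k)

    *-assoc : ∀ x y z → (x Q.* y) Q.* z ≃ x Q.* (y Q.* z)
    *-assoc (f / d [ _ ]) (g / e [ _ ]) (h / k [ _ ]) =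
      crossMultiplied (P.*-cong (P.*-assoc f g h) (P.sym (P.*-assoc d e k)))

    distribˡ : ∀ x y z → x Q.* (y Q.+ z) ≃ (x Q.* y) Q.+ (x Q.* z)
    distribˡ (f / d [ _ ]) (g / e [ _ ]) (h / k [ _ ]) = crossMultiplied (solve 6
      (λ f d g e h k → (f :* (g :* k :+ h :* e)) :* ((d :* e) :* (d :* k))
        := ((f :* g) :* (d :* k) :+ (f :* h) :* (d :* e)) :* (d :* (e :* k))) P.refl f d g e h k)

    -‿inverseˡ : ∀ x → Q.- x Q.+ x ≃ Q.0#
    -‿inverseˡ (f / d [ _ ]) = crossMultiplied (solve 2
      (λ f d → (:- f :* d :+ f :* d) :* 𝟙 := 𝟘 :* (d :* d)) P.refl f d)

  rationalFunctionField : CommutativeRing (c Level.⊔ ℓ₂) ℓ₁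
  rationalFunctionField = record
    { Carrier = RationalFunction R
    ; _≈_ = Q._≈_
    ; _+_ = Q._+_
    ; _*_ = Q._*_
    ; -_  = λ x → Q.- x
    ; 0#  = Q.0#
    ; 1#  = Q.1#
    ; isCommutativeRing = record
      { isRing = record
        { +-isAbelianGroup = record
          { isGroup = record
            { isMonoid = record
              { isSemigroup = record
                { isMagma = record
                  { isEquivalence = record
                    { refl  = λ {x} → ≃⇒≈ {x} {x} (crossMultiplied P.refl)
                    ; sym   = λ {x} {y} x≈y → ≃⇒≈ {y} {x} (crossMultiplied (P.sym (coefficientwise x≈y)))
                    ; trans = λ {x} {y} {z} x≈y y≈z →
                        ≃⇒≈ {x} {z} (≃-trans (≈⇒≃ {x} {y} x≈y) (≈⇒≃ {y} {z} y≈z))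
                    }
                  ; ∙-cong = λ {x} {x′} {y} {y′} x≈x′ y≈y′ →
                      ≃⇒≈ (+-cong (≈⇒≃ {x} {x′} x≈x′) (≈⇒≃ {y} {y′} y≈y′))
                  }
                ; assoc = λ x y z → ≃⇒≈ (+-assoc x y z)
                }
              ; identity = (λ x → ≃⇒≈ (+-identityˡ x))
                         , (λ x → ≃⇒≈ (≃-trans (+-comm x Q.0#) (+-identityˡ x)))
              }
            ; inverse = (λ x → ≃⇒≈ (-‿inverseˡ x))
                      , (λ x → ≃⇒≈ (≃-trans (+-comm x (Q.- x)) (-‿inverseˡ x)))
            ; ⁻¹-cong = λ {x} {y} x≈y → ≃⇒≈ (-‿cong (≈⇒≃ {x} {y} x≈y))
            }
          ; comm = λ x y → ≃⇒≈ (+-comm x y)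
          }
        ; *-cong = λ {x} {x′} {y} {y′} x≈x′ y≈y′ →
            ≃⇒≈ (*-cong (≈⇒≃ {x} {x′} x≈x′) (≈⇒≃ {y} {y′} y≈y′))
        ; *-assoc = λ x y z → ≃⇒≈ (*-assoc x y z)
        ; *-identity = (λ x → ≃⇒≈ (*-identityˡ x))
                     , (λ x → ≃⇒≈ (≃-trans (*-comm x Q.1#) (*-identityˡ x)))
        ; distrib = (λ x y z → ≃⇒≈ (distribˡ x y z))
                  , (λ x y z → ≃⇒≈ (≃-trans (*-comm (y Q.+ z) x) (≃-trans (distribˡ x y z)
                      (+-cong (*-comm x y) (*-comm x z)))))
        }
      ; *-comm = λ x y → ≃⇒≈ (*-comm x y)
      }
    }

-- Descents and insertion

toℕ-punchIn-< : ∀ {n} (j : Fin (suc n)) i → toℕ i ℕ.< toℕ j → toℕ (punchIn j i) ≡ toℕ i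
toℕ-punchIn-< (suc j) zero    i<j = ≡.refl
toℕ-punchIn-< (suc j) (suc i) i<j = ≡.cong suc (toℕ-punchIn-< j i (s≤s⁻¹ i<j))

toℕ-punchIn-≥ : ∀ {n} (j : Fin (suc n)) i → toℕ j ℕ.≤ toℕ i → toℕ (punchIn j i) ≡ suc (toℕ i)
toℕ-punchIn-≥ zero    i       j≤i = ≡.refl
toℕ-punchIn-≥ (suc j) (suc i) j≤i = ≡.cong suc (toℕ-punchIn-≥ j i (s≤s⁻¹ j≤i))

punchIn-<-pivot : ∀ {n} (j : Fin (suc n)) i → (toℕ (punchIn j i) ℕ.< toℕ j) ⇔ (toℕ i ℕ.< toℕ j)
punchIn-<-pivot j i with ℕ.<-≤-connex (toℕ i) (toℕ j)
... | inj₁ i<j rewrite toℕ-punchIn-< j i i<j = mk⇔ (λ p → p) (λ p → p)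
... | inj₂ j≤i rewrite toℕ-punchIn-≥ j i j≤i =
  mk⇔ (λ 1+i<j → contradiction (ℕ.<⇒≤ 1+i<j) (ℕ.≤⇒≯ j≤i)) (λ i<j → contradiction i<j (ℕ.≤⇒≯ j≤i))

punchIn-<-⇔ : ∀ {n} (j : Fin (suc n)) i k → (punchIn j i Fin.< punchIn j k) ⇔ (i Fin.< k)
punchIn-<-⇔ j i k = mk⇔
  (λ p → ℕ.≰⇒> (ℕ.<⇒≱ p ∘ Fin.punchIn-mono-≤ j k i))
  (λ p → ℕ.≰⇒> (ℕ.<⇒≱ p ∘ Fin.punchIn-cancel-≤ j k i))

-- In one-line notation of the inverse, `insert zero j` puts a new least entry 0 at position j of
-- π⁻¹ and raises all other entries by one. All descent arguments below are about this picture.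
insert-inverse-pivot : ∀ {n} (j : Fin (suc n)) (π : Permutation′ n) →
                       Perm.insert zero j π ⟨$⟩ˡ j ≡ zero
insert-inverse-pivot j π = Perm.inverseˡ (Perm.insert zero j π) {zero}

insert-inverse-punchIn : ∀ {n} (j : Fin (suc n)) (π : Permutation′ n) i →
                         Perm.insert zero j π ⟨$⟩ˡ punchIn j i ≡ suc (π ⟨$⟩ˡ i)
insert-inverse-punchIn j π i = ≡.trans
  (≡.cong (λ l → Perm.insert zero j π ⟨$⟩ˡ punchIn j l) (≡.sym (Perm.inverseʳ π)))
  (Perm.inverseˡ (Perm.insert zero j π) {suc (π ⟨$⟩ˡ i)})

IsCut : ∀ {a} → Vec ℕ a → ℕ → Set
IsCut b t = ∃[ k ] t ≡ prefixSum b k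

cut-later : ∀ {a} b {bs : Vec ℕ a} {t} → IsCut bs t → IsCut (b ∷ bs) (b ℕ.+ t)
cut-later b (k , t≡) = suc k , ≡.cong (b ℕ.+_) t≡

cut-sum : ∀ {a} (b : Vec ℕ (suc a)) → IsCut b (Vec.sum b)
cut-sum (b ∷ [])      = zero , ℕ.+-identityʳ b
cut-sum (b ∷ b′ ∷ bs) = cut-later b (cut-sum (b′ ∷ bs))

-- Position j (counted from 0) is the r-th one (counted from 0) of a block of
-- length 1 + m in the composition b, and b′ is b with this block shortened
-- by one.
data At : ∀ {a} (b : Vec ℕ a) (j r m : ℕ) (b′ : Vec ℕ a) → Set where
  here  : ∀ {a m r} {bs : Vec ℕ a} → r ℕ.≤ m → At (suc m ∷ bs) r r m (m ∷ bs)
  there : ∀ {a b j r m} {bs bs′ : Vec ℕ a} →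
          At bs j r m bs′ → At (b ∷ bs) (b ℕ.+ j) r m (b ∷ bs′)

At-sum : ∀ {a j r m} {b b′ : Vec ℕ a} → At b j r m b′ → Vec.sum b ≡ suc (Vec.sum b′)
At-sum (here _)           = ≡.refl
At-sum (there {b = b} at) = ≡.trans (≡.cong (b ℕ.+_) (At-sum at)) (ℕ.+-suc b _)

-- `At` forces a to be positive, which brings any c with a parts into the scope of `cut-sum`.
At-cut-sum : ∀ {a j r m} {b b′ : Vec ℕ a} → At b j r m b′ → (c : Vec ℕ a) → IsCut c (Vec.sum c)
At-cut-sum (here _)  c = cut-sum c
At-cut-sum (there _) c = cut-sum c

At-offset≤ : ∀ {a j r m} {b b′ : Vec ℕ a} → At b j r m b′ → r ℕ.≤ j
At-offset≤ (here _)           = ℕ.≤-refl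
At-offset≤ (there {b = b} at) = ℕ.≤-trans (At-offset≤ at) (ℕ.m≤n+m _ b)

-- A position with positive offset lies strictly between the start of its block and the next larger
-- prefix sum.
interior-not-cut : ∀ {a j r m} {b b′ : Vec ℕ a} → At b j (suc r) m b′ → ¬ IsCut b j
interior-not-cut (here r<m) (zero , ≡.refl)     = ℕ.1+n≰n r<m
interior-not-cut (here r<m) (suc k , ≡.refl)    = ℕ.m+n≮m _ _ r<m
interior-not-cut (there {b = b} at) (zero , eq) =
  contradiction (≡.subst (_ ℕ.≤_) (ℕ.+-cancelˡ-≡ b _ 0 (≡.trans eq (≡.sym (ℕ.+-identityʳ b)))) (At-offset≤ at)) λ ()
interior-not-cut (there {b = b} at) (suc k , eq) =
  interior-not-cut at (k , ℕ.+-cancelˡ-≡ b _ _ eq)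

start-cut : ∀ {a j m} {b b′ : Vec ℕ a} → At b j 0 m b′ → 0 ℕ.< j → IsCut b j
start-cut (there {b = b} {j = zero} at) _ = zero , ℕ.+-identityʳ b
start-cut (there {b = b} {j = suc j} at) _ = cut-later b (start-cut at z<s)

-- The blocks before j agree in b and b′, so the prefix sum that ends at j survives the shortening.
start-cut′ : ∀ {a j m} {b b′ : Vec ℕ a} → At b j 0 m b′ → 0 ℕ.< j → IsCut b′ j
start-cut′ (there {b = b} {j = zero} at) _ = zero , ℕ.+-identityʳ b
start-cut′ (there {b = b} {j = suc j} at) _ = cut-later b (start-cut′ at z<s)

cut-below : ∀ {a j m t} {b b′ : Vec ℕ a} → At b j 0 m b′ → t ℕ.< j → IsCut b t ⇔ IsCut b′ t
cut-below (there {b = b} at) t<j = mk⇔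
  (λ { (zero , eq)      → zero , eq
     ; (suc k , ≡.refl) → cut-later b (to (cut-below at (ℕ.+-cancelˡ-< b _ _ t<j)) (k , ≡.refl)) })
  (λ { (zero , eq)      → zero , eq
     ; (suc k , ≡.refl) → cut-later b (from (cut-below at (ℕ.+-cancelˡ-< b _ _ t<j)) (k , ≡.refl)) })
  where open Equivalence

-- Shortening the block that starts at j moves every later cut down by one. At t = j the equivalence
-- can fail: for j > 0, b′ always has the cut j, but b has the cut 1 + j only if m = 0.
cut-above : ∀ {a j m t} {b b′ : Vec ℕ a} → At b j 0 m b′ → j ℕ.< t → IsCut b (suc t) ⇔ IsCut b′ t
cut-above (here _) j<t = mk⇔
  (λ { (zero , ≡.refl) → zero , ≡.refl ; (suc k , ≡.refl) → suc k , ≡.refl })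
  (λ { (zero , ≡.refl) → zero , ≡.refl ; (suc k , ≡.refl) → suc k , ≡.refl })
cut-above (there {b = b} {j = j} {bs = bs} at) b+j<t
  with t′ , ≡.refl ← ℕ.m≤n⇒∃[o]m+o≡n (ℕ.≤-trans (ℕ.m≤m+n b j) (ℕ.<⇒≤ b+j<t)) = mk⇔
  (λ { (zero , eq)  → contradiction (ℕ.≤-reflexive eq) (ℕ.m+n≮m b t′)
     ; (suc k , eq) → cut-later b (to rec (k , ℕ.+-cancelˡ-≡ b _ _ (≡.trans (ℕ.+-suc b t′) eq))) })
  (λ { (zero , eq)  → contradiction (≡.subst (b ℕ.+ j ℕ.<_) eq b+j<t) (ℕ.m+n≮m b j)
     ; (suc k , eq) → ≡.subst (IsCut (b ∷ bs)) (ℕ.+-suc b t′)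
         (cut-later b (from rec (k , ℕ.+-cancelˡ-≡ b _ _ eq))) })
  where
  open Equivalence
  rec = cut-above at (ℕ.+-cancelˡ-< b j t′ b+j<t)

module _ {n a m : ℕ} {b b′ : Vec ℕ a} (j : Fin (suc n)) (π : Permutation′ n) where

  private
    σ = Perm.insert zero j π

    lift-< : ∀ {i k} → π ⟨$⟩ˡ k Fin.< π ⟨$⟩ˡ i → σ ⟨$⟩ˡ punchIn j k Fin.< σ ⟨$⟩ˡ punchIn j i
    lift-< {i} {k} lt = ≡.subst₂ Fin._<_
      (≡.sym (insert-inverse-punchIn j π k)) (≡.sym (insert-inverse-punchIn j π i)) (s<s lt)

    lower-< : ∀ {i k} → σ ⟨$⟩ˡ punchIn j k Fin.< σ ⟨$⟩ˡ punchIn j i → π ⟨$⟩ˡ k Fin.< π ⟨$⟩ˡ i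
    lower-< {i} {k} lt = s≤s⁻¹ (≡.subst₂ Fin._<_
      (insert-inverse-punchIn j π k) (insert-inverse-punchIn j π i) lt)

  -- In σ⁻¹ the least entry stands at j. A descent into it is allowed, as j is a cut or there is
  -- nothing before it, and the step out of it is an ascent. Every other adjacent pair of σ⁻¹ is
  -- adjacent in π⁻¹ too, and its cut condition is transferred by `cut-below` or `cut-above`.
  insert-within⇔ : At b (toℕ j) 0 m b′ → Vec.sum b′ ≡ n →
                   DescentsWithin b (Perm.flip σ) ⇔ DescentsWithin b′ (Perm.flip π)
  insert-within⇔ at ∑b′≡n = mk⇔ forward backward
    where
    open Equivalence

    forward : DescentsWithin b (Perm.flip σ) → DescentsWithin b′ (Perm.flip π)
    forward within i (inj₁ 1+i≡n) =
      ≡.subst (IsCut b′) (≡.trans ∑b′≡n (≡.sym 1+i≡n)) (At-cut-sum at b′)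
    forward within i (inj₂ (k , k≡1+i , lt)) with ℕ.<-cmp (suc (toℕ i)) (toℕ j)
    ... | tri< 1+i<j _ _ = to (cut-below at 1+i<j)
      (≡.subst (IsCut b ∘ suc) i′≡i (within (punchIn j i) (inj₂ (punchIn j k , adjacent , lift-< lt))))
      where
      i′≡i : toℕ (punchIn j i) ≡ toℕ i
      i′≡i = toℕ-punchIn-< j i (ℕ.<⇒≤ 1+i<j)
      adjacent : toℕ (punchIn j k) ≡ suc (toℕ (punchIn j i))
      adjacent = ≡.trans (toℕ-punchIn-< j k (≡.subst (ℕ._< toℕ j) (≡.sym k≡1+i) 1+i<j))
        (≡.trans k≡1+i (≡.cong suc (≡.sym i′≡i)))
    -- This pair of π⁻¹ is separated in σ⁻¹ by the least entry, so nothing is known about it; but j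
    -- is a cut of b′, so a descent is harmless.
    ... | tri≈ _ 1+i≡j _ = ≡.subst (IsCut b′) (≡.sym 1+i≡j) (start-cut′ at (≡.subst (0 ℕ.<_) 1+i≡j z<s))
    ... | tri> _ _ j<1+i = to (cut-above at j<1+i)
      (≡.subst (IsCut b ∘ suc) i′≡1+i (within (punchIn j i) (inj₂ (punchIn j k , adjacent , lift-< lt))))
      where
      i′≡1+i : toℕ (punchIn j i) ≡ suc (toℕ i)
      i′≡1+i = toℕ-punchIn-≥ j i (s≤s⁻¹ j<1+i)
      adjacent : toℕ (punchIn j k) ≡ suc (toℕ (punchIn j i))
      adjacent = ≡.trans (toℕ-punchIn-≥ j k (≡.subst (toℕ j ℕ.≤_) (≡.sym k≡1+i) (ℕ.<⇒≤ j<1+i)))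
        (≡.cong suc (≡.trans k≡1+i (≡.sym i′≡1+i)))

    backward-punchIn : DescentsWithin b′ (Perm.flip π) → ∀ i k →
                       toℕ (punchIn j k) ≡ suc (toℕ (punchIn j i)) → π ⟨$⟩ˡ k Fin.< π ⟨$⟩ˡ i →
                       IsCut b (suc (toℕ (punchIn j i)))
    backward-punchIn within i k k′≡1+i′ lt
      with ℕ.<-≤-connex (toℕ i) (toℕ j) | ℕ.<-≤-connex (toℕ k) (toℕ j)
    ... | inj₁ i<j | inj₁ k<j rewrite toℕ-punchIn-< j i i<j | toℕ-punchIn-< j k k<j =
      from (cut-below at (≡.subst (ℕ._< toℕ j) k′≡1+i′ k<j)) (within i (inj₂ (k , k′≡1+i′ , lt)))
    -- Positions on opposite sides of the skipped j cannot be adjacent, which rules out both mixed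
    -- cases.
    ... | inj₁ i<j | inj₂ j≤k rewrite toℕ-punchIn-< j i i<j | toℕ-punchIn-≥ j k j≤k =
      contradiction (≡.subst (toℕ j ℕ.≤_) (ℕ.suc-injective k′≡1+i′) j≤k) (ℕ.<⇒≱ i<j)
    ... | inj₂ j≤i | inj₁ k<j rewrite toℕ-punchIn-≥ j i j≤i | toℕ-punchIn-< j k k<j =
      contradiction (≡.subst (ℕ._< toℕ j) k′≡1+i′ k<j) (ℕ.≤⇒≯ (ℕ.m≤n⇒m≤1+n (ℕ.m≤n⇒m≤1+n j≤i)))
    ... | inj₂ j≤i | inj₂ j≤k rewrite toℕ-punchIn-≥ j i j≤i | toℕ-punchIn-≥ j k j≤k =
      from (cut-above at (s≤s j≤i)) (within i (inj₂ (k , ℕ.suc-injective k′≡1+i′ , lt)))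

    backward : DescentsWithin b′ (Perm.flip π) → DescentsWithin b (Perm.flip σ)
    backward within i (inj₁ 1+i≡1+n) = ≡.subst (IsCut b)
      (≡.trans (At-sum at) (≡.trans (≡.cong suc ∑b′≡n) (≡.sym 1+i≡1+n))) (At-cut-sum at b)
    backward within i (inj₂ (k , k≡1+i , lt)) = compare (j Fin.≟ i) (j Fin.≟ k)
      where
      compare : Dec (j ≡ i) → Dec (j ≡ k) → IsCut b (suc (toℕ i))
      -- The pair starts at the least entry, so it is no descent. In the next case the pair ends
      -- there, and the cut at j is used.
      compare (yes j≡i) _ = contradiction lt ((λ ()) ∘ ≡.subst (λ v → σ ⟨$⟩ˡ k Fin.< v)
        (≡.trans (≡.cong (σ ⟨$⟩ˡ_) (≡.sym j≡i)) (insert-inverse-pivot j π)))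
      compare (no _) (yes j≡k) = ≡.subst (IsCut b) j≡1+i (start-cut at (≡.subst (0 ℕ.<_) (≡.sym j≡1+i) z<s))
        where j≡1+i = ≡.trans (≡.cong toℕ j≡k) k≡1+i
      compare (no j≢i) (no j≢k) = ≡.subst (IsCut b ∘ suc ∘ toℕ) i≡
        (backward-punchIn within (punchOut j≢i) (punchOut j≢k)
          (≡.subst₂ (λ v w → toℕ w ≡ suc (toℕ v)) (≡.sym i≡) (≡.sym k≡) k≡1+i)
          (lower-< (≡.subst₂ (λ v w → σ ⟨$⟩ˡ w Fin.< σ ⟨$⟩ˡ v) (≡.sym i≡) (≡.sym k≡) lt)))
        where
        i≡ = Fin.punchIn-punchOut j≢i
        k≡ = Fin.punchIn-punchOut j≢k

-- The least entry of σ⁻¹ at j is preceded by a larger entry, so there is a descent at j, in the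
-- interior of a block.
insert-not-within : ∀ {n a r m} {b b′ : Vec ℕ a} (j : Fin (suc n)) (π : Permutation′ n) →
                    At b (toℕ j) (suc r) m b′ → ¬ DescentsWithin b (Perm.flip (Perm.insert zero j π))
insert-not-within zero    π at with () ← At-offset≤ at
insert-not-within {b = b} (suc j) π at within =
  interior-not-cut at (≡.subst (IsCut b) 1+i≡j (within i (inj₂ (suc j , ≡.sym 1+i≡j , first))))
  where
  σ = Perm.insert zero (suc j) π
  i = punchIn (suc j) j

  1+i≡j : suc (toℕ i) ≡ toℕ (suc j)
  1+i≡j = ≡.cong suc (toℕ-punchIn-< (suc j) j (ℕ.n<1+n (toℕ j)))

  first : σ ⟨$⟩ˡ suc j Fin.< σ ⟨$⟩ˡ i
  first = ≡.subst₂ Fin._<_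
    (≡.sym (insert-inverse-pivot (suc j) π)) (≡.sym (insert-inverse-punchIn (suc j) π j)) z<s

-- Inversions of the permutations with prescribed descents

module ListSums {k ℓ} (K : CommutativeSemiring k ℓ) where
  open CommutativeSemiring K hiding (zero)
  open import Algebra.Properties.Semiring.Sum semiring public
    using (sum; sum-cong-≋; sum-replicate-zero; *-distribʳ-sum; *-distribˡ-sum; ∑-permute)
  open import Algebra.Properties.CommutativeSemigroup +-commutativeSemigroup using (interchange)

  private variable
    a b c : Level
    A B C : Set a

  ∑ᴸ : (A → Carrier) → List A → Carrier
  ∑ᴸ f xs = List.foldr _+_ 0# (List.map f xs)

  ∑ᴸ-cong : ∀ {f g : A → Carrier} → (∀ x → f x ≈ g x) → ∀ xs → ∑ᴸ f xs ≈ ∑ᴸ g xs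
  ∑ᴸ-cong f≈g []       = refl
  ∑ᴸ-cong f≈g (x ∷ xs) = +-cong (f≈g x) (∑ᴸ-cong f≈g xs)

  ∑ᴸ-cong-All : ∀ {f g : A → Carrier} {xs} → All (λ x → f x ≈ g x) xs → ∑ᴸ f xs ≈ ∑ᴸ g xs
  ∑ᴸ-cong-All []          = refl
  ∑ᴸ-cong-All (eq ∷ eqs) = +-cong eq (∑ᴸ-cong-All eqs)

  ∑ᴸ-zero : ∀ (xs : List A) → ∑ᴸ (λ _ → 0#) xs ≈ 0#
  ∑ᴸ-zero []       = refl
  ∑ᴸ-zero (x ∷ xs) = trans (+-identityˡ _) (∑ᴸ-zero xs)

  ∑ᴸ-++ : ∀ (f : A → Carrier) xs ys → ∑ᴸ f (xs List.++ ys) ≈ ∑ᴸ f xs + ∑ᴸ f ys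
  ∑ᴸ-++ f []       ys = sym (+-identityˡ _)
  ∑ᴸ-++ f (x ∷ xs) ys = trans (+-congˡ (∑ᴸ-++ f xs ys)) (sym (+-assoc _ _ _))

  ∑ᴸ-+ : ∀ (f g : A → Carrier) xs → ∑ᴸ (λ x → f x + g x) xs ≈ ∑ᴸ f xs + ∑ᴸ g xs
  ∑ᴸ-+ f g []       = sym (+-identityˡ 0#)
  ∑ᴸ-+ f g (x ∷ xs) = trans (+-congˡ (∑ᴸ-+ f g xs)) (interchange _ _ _ _)

  *-distribˡ-∑ᴸ : ∀ x (f : A → Carrier) ys → x * ∑ᴸ f ys ≈ ∑ᴸ (λ y → x * f y) ys
  *-distribˡ-∑ᴸ x f []       = zeroʳ x
  *-distribˡ-∑ᴸ x f (y ∷ ys) = trans (distribˡ _ _ _) (+-congˡ (*-distribˡ-∑ᴸ x f ys))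

  *-distribʳ-∑ᴸ : ∀ x (f : A → Carrier) ys → ∑ᴸ f ys * x ≈ ∑ᴸ (λ y → f y * x) ys
  *-distribʳ-∑ᴸ x f []       = zeroˡ x
  *-distribʳ-∑ᴸ x f (y ∷ ys) = trans (distribʳ _ _ _) (+-congˡ (*-distribʳ-∑ᴸ x f ys))

  ∑ᴸ-tabulate : ∀ {n} (f : A → Carrier) (g : Fin n → A) → ∑ᴸ f (List.tabulate g) ≡ sum (f ∘ g)
  ∑ᴸ-tabulate {n = zero}  f g = ≡.refl
  ∑ᴸ-tabulate {n = suc n} f g = ≡.cong (f (g zero) +_) (∑ᴸ-tabulate f (g ∘ suc))

  ∑ᴸ-allFin : ∀ {n} (f : Fin n → Carrier) → ∑ᴸ f (allFin n) ≡ sum f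
  ∑ᴸ-allFin f = ∑ᴸ-tabulate f λ i → i

  ∑ᴸ-applyUpTo : ∀ (f : A → Carrier) g n → ∑ᴸ f (List.applyUpTo g n) ≡ sum {n} (f ∘ g ∘ toℕ)
  ∑ᴸ-applyUpTo f g zero    = ≡.refl
  ∑ᴸ-applyUpTo f g (suc n) = ≡.cong (f (g 0) +_) (∑ᴸ-applyUpTo f (g ∘ suc) n)

  ∑ᴸ-map : ∀ (f : B → Carrier) (g : A → B) xs → ∑ᴸ f (List.map g xs) ≡ ∑ᴸ (f ∘ g) xs
  ∑ᴸ-map f g xs = ≡.cong (List.foldr _+_ 0#) (≡.sym (List.map-∘ xs))

  ∑ᴸ-concatMap : ∀ (f : B → Carrier) (g : A → List B) xs →
                 ∑ᴸ f (List.concatMap g xs) ≈ ∑ᴸ (λ x → ∑ᴸ f (g x)) xs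
  ∑ᴸ-concatMap f g []       = refl
  ∑ᴸ-concatMap f g (x ∷ xs) = trans (∑ᴸ-++ f (g x) _) (+-congˡ (∑ᴸ-concatMap f g xs))

  ∑ᴸ-comm : ∀ (f : A → B → Carrier) xs ys →
            ∑ᴸ (λ x → ∑ᴸ (f x) ys) xs ≈ ∑ᴸ (λ y → ∑ᴸ (λ x → f x y) xs) ys
  ∑ᴸ-comm f []       ys = sym (∑ᴸ-zero ys)
  ∑ᴸ-comm f (x ∷ xs) ys = trans (+-congˡ (∑ᴸ-comm f xs ys)) (sym (∑ᴸ-+ (f x) _ ys))

  ∑ᴸ-cartesianProductWith : ∀ (f : C → Carrier) (g : A → B → C) xs ys →
    ∑ᴸ f (List.cartesianProductWith g xs ys) ≈ ∑ᴸ (λ x → ∑ᴸ (λ y → f (g x y)) ys) xs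
  ∑ᴸ-cartesianProductWith f g []       ys = refl
  ∑ᴸ-cartesianProductWith f g (x ∷ xs) ys = trans (∑ᴸ-++ f (List.map (g x) ys) _)
    (+-cong (reflexive (∑ᴸ-map f (g x) ys)) (∑ᴸ-cartesianProductWith f g xs ys))

  when : Bool → Carrier → Carrier
  when b x = if b then x else 0#

  when-cong : ∀ {b c x y} → b ≡ c → x ≈ y → when b x ≈ when c y
  when-cong {false} ≡.refl x≈y = refl
  when-cong {true}  ≡.refl x≈y = x≈y

  *-when : ∀ x b y → x * when b y ≈ when b (x * y)
  *-when x false y = zeroʳ x
  *-when x true  y = refl

private
  module ∑ℕ = ListSums ℕ.+-*-commutativeSemiring

length-filter : ∀ {a p} {A : Set a} {P : A → Set p} (P? : Decidable P) xs →
                List.length (List.filter P? xs) ≡ ∑ℕ.∑ᴸ (λ x → ∑ℕ.when (does (P? x)) 1) xs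
length-filter P? []       = ≡.refl
length-filter P? (x ∷ xs) with does (P? x)
... | false = length-filter P? xs
... | true  = ≡.cong suc (length-filter P? xs)

private
  inverted : ∀ {n} → Permutation′ n → Fin n → Fin n → ℕ
  inverted π i j = ∑ℕ.when (does ((i Fin.<? j) ×-dec (π ⟨$⟩ʳ j Fin.<? π ⟨$⟩ʳ i))) 1

  -- As a double sum over `Fin n`, the count computes on `suc n`, so that the pairs containing 0
  -- split off.
  Inv-sum : ∀ {n} (π : Permutation′ n) → Inv π ≡ ∑ℕ.sum λ i → ∑ℕ.sum λ j → inverted π i j
  Inv-sum {n} π = begin
    Inv π                                                          ≡⟨ length-filter _ (List.cartesianProduct (allFin n) (allFin n)) ⟩
    _                                                              ≡⟨ ∑ℕ.∑ᴸ-cartesianProductWith _ _,_ (allFin n) (allFin n) ⟩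
    ∑ℕ.∑ᴸ (λ i → ∑ℕ.∑ᴸ (inverted π i) (allFin n)) (allFin n)       ≡⟨ ∑ℕ.∑ᴸ-allFin (λ i → ∑ℕ.∑ᴸ (inverted π i) (allFin n)) ⟩
    ∑ℕ.sum (λ i → ∑ℕ.∑ᴸ (inverted π i) (allFin n))                 ≡⟨ ∑ℕ.sum-cong-≋ (λ i → ∑ℕ.∑ᴸ-allFin (inverted π i)) ⟩
    ∑ℕ.sum (λ i → ∑ℕ.sum λ j → inverted π i j)                     ∎
    where open ≡.≡-Reasoning

  count-below : ∀ {m n} → m ℕ.≤ n → ∑ℕ.sum {n} (λ v → ∑ℕ.when (does (toℕ v ℕ.<? m)) 1) ≡ m
  count-below {n = n} z≤n = ∑ℕ.sum-replicate-zero n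
  count-below (s≤s m≤n)   = ≡.cong suc (count-below m≤n)

-- The first value j is inverted with exactly the values below j, and since π is a bijection there
-- are j of them. `punchIn j` is strictly monotone, so the remaining pairs are inverted as in π.
Inv-insert : ∀ {n} (j : Fin (suc n)) (π : Permutation′ n) →
             Inv (Perm.insert zero j π) ≡ toℕ j ℕ.+ Inv π
Inv-insert {n} j π = begin
  Inv σ
    -- The pairs whose second index is 0 vanish by computation.
    ≡⟨ Inv-sum σ ⟩
  ∑ℕ.sum {n} (λ l → ∑ℕ.when (does (punchIn j (π ⟨$⟩ʳ l) Fin.<? j)) 1)
    ℕ.+ ∑ℕ.sum (λ i → ∑ℕ.sum λ l → inverted σ (suc i) (suc l))
    ≡⟨ ≡.cong₂ ℕ._+_
         (∑ℕ.sum-cong-≋ λ l → ∑ℕ.when-cong (does-⇔ (punchIn-<-pivot j (π ⟨$⟩ʳ l)) (_ ℕ.<? _) (_ ℕ.<? _)) ≡.refl)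
         (∑ℕ.sum-cong-≋ λ i → ∑ℕ.sum-cong-≋ λ l → ∑ℕ.when-cong
            (≡.cong (does (i Fin.<? l) ∧_)
              (does-⇔ (punchIn-<-⇔ j (π ⟨$⟩ʳ l) (π ⟨$⟩ʳ i)) (_ ℕ.<? _) (_ ℕ.<? _))) ≡.refl) ⟩
  ∑ℕ.sum {n} (λ l → ∑ℕ.when (does (toℕ (π ⟨$⟩ʳ l) ℕ.<? toℕ j)) 1)
    ℕ.+ ∑ℕ.sum (λ i → ∑ℕ.sum λ l → inverted π i l)
    ≡⟨ ≡.cong₂ ℕ._+_ (∑ℕ.∑-permute (λ v → ∑ℕ.when (does (toℕ v ℕ.<? toℕ j)) 1) π) (Inv-sum π) ⟨
  ∑ℕ.sum {n} (λ v → ∑ℕ.when (does (toℕ v ℕ.<? toℕ j)) 1) ℕ.+ Inv π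
    ≡⟨ ≡.cong (ℕ._+ Inv π) (count-below (s≤s⁻¹ (Fin.toℕ<n j))) ⟩
  toℕ j ℕ.+ Inv π
    ∎
  where
  open ≡.≡-Reasoning
  σ = Perm.insert zero j π

module QCounting {k ℓ} (K : CommutativeSemiring k ℓ) (q : CommutativeSemiring.Carrier K) where
  open CommutativeSemiring K hiding (zero)
  open ListSums K
  open import Algebra.Properties.Semiring.Exp semiring using (_^_; ^-homo-*; ^-congʳ)
  open import Algebra.Properties.CommutativeSemigroup *-commutativeSemigroup using (x∙yz≈y∙xz)
  open SetoidReasoning setoid

  infix 10 ⟨_⟩ ⟨_⟩!

  -- The q-integer in Horner form, which makes its recursion definitional.
  ⟨_⟩ : ℕ → Carrier
  ⟨ zero ⟩  = 0#
  ⟨ suc n ⟩ = 1# + q * ⟨ n ⟩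

  ⟨_⟩! : ℕ → Carrier
  ⟨ zero ⟩!  = 1#
  ⟨ suc n ⟩! = ⟨ suc n ⟩ * ⟨ n ⟩!

  ∏⟨_⟩! : ∀ {a} → Vec ℕ a → Carrier
  ∏⟨ [] ⟩!     = 1#
  ∏⟨ b ∷ bs ⟩! = ⟨ b ⟩! * ∏⟨ bs ⟩!

  ⟨⟩-+ : ∀ m n → ⟨ m ℕ.+ n ⟩ ≈ ⟨ m ⟩ + q ^ m * ⟨ n ⟩
  ⟨⟩-+ zero    n = sym (trans (+-identityˡ _) (*-identityˡ _))
  ⟨⟩-+ (suc m) n = begin
    1# + q * ⟨ m ℕ.+ n ⟩                      ≈⟨ +-congˡ (*-congˡ (⟨⟩-+ m n)) ⟩
    1# + q * (⟨ m ⟩ + q ^ m * ⟨ n ⟩)          ≈⟨ +-congˡ (distribˡ q _ _) ⟩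
    1# + (q * ⟨ m ⟩ + q * (q ^ m * ⟨ n ⟩))    ≈⟨ +-assoc _ _ _ ⟨
    1# + q * ⟨ m ⟩ + q * (q ^ m * ⟨ n ⟩)      ≈⟨ +-congˡ (*-assoc q _ _) ⟨
    1# + q * ⟨ m ⟩ + q * q ^ m * ⟨ n ⟩        ∎

  ∏⟨⟩!-sum-0 : ∀ {a} (b : Vec ℕ a) → Vec.sum b ≡ 0 → ∏⟨ b ⟩! ≈ 1#
  ∏⟨⟩!-sum-0 []         _  = refl
  ∏⟨⟩!-sum-0 (zero ∷ b) eq = trans (*-identityˡ _) (∏⟨⟩!-sum-0 b eq)

  ∏⟨⟩!-At : ∀ {a j r m} {b b′ : Vec ℕ a} → At b j r m b′ → ∏⟨ b ⟩! ≈ ⟨ suc m ⟩ * ∏⟨ b′ ⟩!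
  ∏⟨⟩!-At (here _)   = *-assoc _ _ _
  ∏⟨⟩!-At (there at) = trans (*-congˡ (∏⟨⟩!-At at)) (x∙yz≈y∙xz _ _ _)

  sum-++ : ∀ m {n} (f : Fin (m ℕ.+ n) → Carrier) →
           sum f ≈ sum (f ∘ (_↑ˡ n)) + sum (f ∘ (m ↑ʳ_))
  sum-++ zero    f = sym (+-identityˡ _)
  sum-++ (suc m) f = trans (+-congˡ (sum-++ m (f ∘ suc))) (sym (+-assoc _ _ _))

  -- A block of length m + 1 starting at j contributes `q ^ j * ⟨ suc m ⟩ * w`, and `⟨⟩-+` joins
  -- these contributions. Empty blocks have no start, in agreement with `⟨ 0 ⟩` being 0. The
  -- function f is abstract so that the induction on the blocks can shift it.
  sum-starts : ∀ {a} (b : Vec ℕ a) w (f : Fin (Vec.sum b) → Carrier) →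
               (∀ {j m b′} → At b (toℕ j) 0 m b′ → f j ≈ ⟨ suc m ⟩ * w) →
               (∀ {j r m b′} → At b (toℕ j) (suc r) m b′ → f j ≈ 0#) →
               sum (λ j → q ^ toℕ j * f j) ≈ ⟨ Vec.sum b ⟩ * w
  sum-starts []       w f f-start f-rest = sym (zeroˡ w)
  sum-starts (b ∷ bs) w f f-start f-rest = begin
    sum (λ j → q ^ toℕ j * f j)
      ≈⟨ sum-++ b _ ⟩
    sum (λ j → q ^ toℕ (j ↑ˡ s) * f (j ↑ˡ s)) + sum (λ j → q ^ toℕ (b ↑ʳ j) * f (b ↑ʳ j))
      ≈⟨ +-cong (first b f f-start f-rest) later ⟩
    ⟨ b ⟩ * w + q ^ b * (⟨ s ⟩ * w)
      ≈⟨ +-congˡ (*-assoc _ _ w) ⟨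
    ⟨ b ⟩ * w + q ^ b * ⟨ s ⟩ * w
      ≈⟨ distribʳ w _ _ ⟨
    (⟨ b ⟩ + q ^ b * ⟨ s ⟩) * w
      ≈⟨ *-congʳ (⟨⟩-+ b s) ⟨
    ⟨ b ℕ.+ s ⟩ * w
      ∎
    where
    s = Vec.sum bs

    first : ∀ b (f : Fin (b ℕ.+ s) → Carrier) →
            (∀ {j m b′} → At (b ∷ bs) (toℕ j) 0 m b′ → f j ≈ ⟨ suc m ⟩ * w) →
            (∀ {j r m b′} → At (b ∷ bs) (toℕ j) (suc r) m b′ → f j ≈ 0#) →
            sum (λ j → q ^ toℕ (j ↑ˡ s) * f (j ↑ˡ s)) ≈ ⟨ b ⟩ * w
    first zero    f f-start f-rest = sym (zeroˡ w)
    first (suc m) f f-start f-rest = begin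
      1# * f zero + sum (λ j → q ^ suc (toℕ (j ↑ˡ s)) * f (suc j ↑ˡ s))
        ≈⟨ +-cong (*-identityˡ _) (sum-cong-≋ λ j → trans
             (*-congˡ (f-rest (≡.subst (λ r → At _ (suc r) (suc r) m _)
               (≡.sym (Fin.toℕ-↑ˡ j s)) (here (Fin.toℕ<n j)))))
             (zeroʳ _)) ⟩
      f zero + sum {m} (λ _ → 0#)
        ≈⟨ +-cong (f-start (here z≤n)) (sum-replicate-zero m) ⟩
      ⟨ suc m ⟩ * w + 0#
        ≈⟨ +-identityʳ _ ⟩
      ⟨ suc m ⟩ * w
        ∎

    later : sum (λ j → q ^ toℕ (b ↑ʳ j) * f (b ↑ʳ j)) ≈ q ^ b * (⟨ s ⟩ * w)
    later = begin
      sum (λ j → q ^ toℕ (b ↑ʳ j) * f (b ↑ʳ j))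
        ≈⟨ sum-cong-≋ {s} (λ j → *-congʳ (trans (^-congʳ q (Fin.toℕ-↑ʳ b j)) (^-homo-* q b (toℕ j)))) ⟩
      sum (λ j → q ^ b * q ^ toℕ j * f (b ↑ʳ j))
        ≈⟨ sum-cong-≋ {s} (λ j → *-assoc _ _ _) ⟩
      sum (λ j → q ^ b * (q ^ toℕ j * f (b ↑ʳ j)))
        ≈⟨ *-distribˡ-sum (q ^ b) (λ j → q ^ toℕ j * f (b ↑ʳ j)) ⟨
      q ^ b * sum (λ j → q ^ toℕ j * f (b ↑ʳ j))
        ≈⟨ *-congˡ (sum-starts bs w (f ∘ (b ↑ʳ_))
             (λ at → f-start (shifted at)) (λ at → f-rest (shifted at))) ⟩
      q ^ b * (⟨ s ⟩ * w)
        ∎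
      where
      shifted : ∀ {j r m b′} → At bs (toℕ j) r m b′ → At (b ∷ bs) (toℕ (b ↑ʳ j)) r m (b ∷ b′)
      shifted at = ≡.subst (λ j → At _ j _ _ _) (≡.sym (Fin.toℕ-↑ʳ b _)) (there at)

  within : ∀ {n a} → Vec ℕ a → Permutation′ n → Bool
  within b π = does (descentsWithin? b (Perm.flip π))

  -- The q-multinomial theorem for inversions, without division. At a block start j, `∏⟨ b ⟩!` is
  -- `⟨ suc m ⟩` times `∏⟨ b′ ⟩!`; the induction hypothesis for b′ absorbs the second factor and
  -- leaves the weight `⟨ suc m ⟩` required by `sum-starts`.
  inversions-within : ∀ {a} n (b : Vec ℕ a) → Vec.sum b ≡ n →
    ∑ᴸ (λ π → when (within b π) (q ^ Inv π)) (permutations n) * ∏⟨ b ⟩! ≈ ⟨ n ⟩!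
  inversions-within zero    b ∑b≡0 = begin
    (when (within {zero} b Perm.id) 1# + 0#) * ∏⟨ b ⟩!
      ≈⟨ *-cong (trans (+-identityʳ _) (when-cong (dec-true (descentsWithin? {zero} b Perm.id) λ ()) refl)) (∏⟨⟩!-sum-0 b ∑b≡0) ⟩
    1# * 1#
      ≈⟨ *-identityˡ 1# ⟩
    1#
      ∎
  inversions-within (suc n) b ∑b≡1+n = begin
    ∑ᴸ (λ π → when (within b π) (q ^ Inv π)) (permutations (suc n)) * ∏⟨ b ⟩!
      ≈⟨ *-congʳ (∑ᴸ-cartesianProductWith _ (Perm.insert zero) (allFin (suc n)) (permutations n)) ⟩
    ∑ᴸ (λ j → ∑ᴸ (λ π → when (within b (σ j π)) (q ^ Inv (σ j π))) (permutations n)) (allFin (suc n)) * ∏⟨ b ⟩!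
      ≈⟨ *-congʳ (∑ᴸ-cong (λ j → trans
           (∑ᴸ-cong (λ π → trans
              (when-cong {within b (σ j π)} ≡.refl (trans (^-congʳ q (Inv-insert j π)) (^-homo-* q (toℕ j) (Inv π))))
              (sym (*-when _ (within b (σ j π)) _))) (permutations n))
           (sym (*-distribˡ-∑ᴸ (q ^ toℕ j) _ (permutations n)))) (allFin (suc n))) ⟩
    ∑ᴸ (λ j → q ^ toℕ j * g j) (allFin (suc n)) * ∏⟨ b ⟩!
      ≈⟨ *-congʳ (reflexive (∑ᴸ-allFin (λ j → q ^ toℕ j * g j))) ⟩
    sum (λ j → q ^ toℕ j * g j) * ∏⟨ b ⟩!
      ≈⟨ *-distribʳ-sum ∏⟨ b ⟩! (λ j → q ^ toℕ j * g j) ⟩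
    sum (λ j → q ^ toℕ j * g j * ∏⟨ b ⟩!)
      ≈⟨ sum-cong-≋ {suc n} (λ j → *-assoc (q ^ toℕ j) (g j) ∏⟨ b ⟩!) ⟩
    sum (λ j → q ^ toℕ j * (g j * ∏⟨ b ⟩!))
      ≈⟨ starts (suc n) ∑b≡1+n _ g-start g-rest ⟩
    ⟨ suc n ⟩ * ⟨ n ⟩!
      ∎
    where
    σ : Fin (suc n) → Permutation′ n → Permutation′ (suc n)
    σ = Perm.insert zero

    g : Fin (suc n) → Carrier
    g j = ∑ᴸ (λ π → when (within b (σ j π)) (q ^ Inv π)) (permutations n)

    -- Positions are indexed by `Fin (suc n)` here but by `Fin (Vec.sum b)` in `sum-starts`. With
    -- suc n generalised to N, the equation can be matched with `refl`.
    starts : ∀ N → Vec.sum b ≡ N → (f : Fin N → Carrier) →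
             (∀ {j m b′} → At b (toℕ j) 0 m b′ → f j ≈ ⟨ suc m ⟩ * ⟨ n ⟩!) →
             (∀ {j r m b′} → At b (toℕ j) (suc r) m b′ → f j ≈ 0#) →
             sum (λ j → q ^ toℕ j * f j) ≈ ⟨ N ⟩ * ⟨ n ⟩!
    starts _ ≡.refl = sum-starts b ⟨ n ⟩!

    g-start : ∀ {j m b′} → At b (toℕ j) 0 m b′ → g j * ∏⟨ b ⟩! ≈ ⟨ suc m ⟩ * ⟨ n ⟩!
    g-start {j} {m} {b′} at = begin
      g j * ∏⟨ b ⟩!
        ≈⟨ *-cong
             (∑ᴸ-cong (λ π → when-cong (does-⇔ (insert-within⇔ j π at ∑b′≡n)
               (descentsWithin? b (Perm.flip (σ j π))) (descentsWithin? b′ (Perm.flip π))) refl) (permutations n))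
             (∏⟨⟩!-At at) ⟩
      ∑ᴸ (λ π → when (within b′ π) (q ^ Inv π)) (permutations n) * (⟨ suc m ⟩ * ∏⟨ b′ ⟩!)
        ≈⟨ x∙yz≈y∙xz _ _ _ ⟩
      ⟨ suc m ⟩ * (∑ᴸ (λ π → when (within b′ π) (q ^ Inv π)) (permutations n) * ∏⟨ b′ ⟩!)
        ≈⟨ *-congˡ (inversions-within n b′ ∑b′≡n) ⟩
      ⟨ suc m ⟩ * ⟨ n ⟩!
        ∎
      where
      ∑b′≡n : Vec.sum b′ ≡ n
      ∑b′≡n = ℕ.suc-injective (≡.trans (≡.sym (At-sum at)) ∑b≡1+n)

    g-rest : ∀ {j r m b′} → At b (toℕ j) (suc r) m b′ → g j * ∏⟨ b ⟩! ≈ 0#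
    g-rest {j} at = trans
      (*-congʳ (trans
        (∑ᴸ-cong (λ π → when-cong (dec-false (descentsWithin? b (Perm.flip (σ j π))) (insert-not-within j π at)) refl) (permutations n))
        (∑ᴸ-zero (permutations n))))
      (zeroˡ _)

-- The first equality

private
  module Q₁ = QCounting ℕ.+-*-commutativeSemiring 1

  open import Algebra.Properties.Semiring.Exp ℕ.+-*-semiring using () renaming (_^_ to _^ℕ_)

  ⟨⟩₁ : ∀ n → Q₁.⟨ n ⟩ ≡ n
  ⟨⟩₁ zero    = ≡.refl
  ⟨⟩₁ (suc n) = ≡.cong suc (≡.trans (ℕ.*-identityˡ _) (⟨⟩₁ n))

  ⟨⟩!₁ : ∀ n → Q₁.⟨ n ⟩! ≡ n !
  ⟨⟩!₁ zero    = ≡.refl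
  ⟨⟩!₁ (suc n) = ≡.cong₂ ℕ._*_ (⟨⟩₁ (suc n)) (⟨⟩!₁ n)

  ∏⟨⟩!₁ : ∀ {a} (b : Vec ℕ a) → Q₁.∏⟨ b ⟩! ≡ ∏! b
  ∏⟨⟩!₁ []       = ≡.refl
  ∏⟨⟩!₁ (b ∷ bs) = ≡.cong₂ ℕ._*_ (⟨⟩!₁ b) (∏⟨⟩!₁ bs)

  1^n≡1 : ∀ n → 1 ^ℕ n ≡ 1
  1^n≡1 zero    = ≡.refl
  1^n≡1 (suc n) = ≡.trans (ℕ.*-identityˡ _) (1^n≡1 n)

count-within : ∀ {a} → ℕ → Vec ℕ a → ℕ
count-within n b = List.length (List.filter (λ σ → descentsWithin? b (Perm.flip σ)) (permutations n))

count-within-* : ∀ {a} n (b : Vec ℕ a) → Vec.sum b ≡ n → count-within n b ℕ.* ∏! b ≡ n !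
count-within-* n b ∑b≡n = begin
  count-within n b ℕ.* ∏! b
    ≡⟨ ≡.cong (ℕ._* ∏! b) (length-filter (λ σ → descentsWithin? b (Perm.flip σ)) (permutations n)) ⟩
  ∑ℕ.∑ᴸ (λ π → ∑ℕ.when (Q₁.within b π) 1) (permutations n) ℕ.* ∏! b
    ≡⟨ ≡.cong₂ ℕ._*_
         (∑ℕ.∑ᴸ-cong (λ π → ≡.cong (∑ℕ.when (Q₁.within b π)) (1^n≡1 (Inv π))) (permutations n))
         (∏⟨⟩!₁ b) ⟨
  ∑ℕ.∑ᴸ (λ π → ∑ℕ.when (Q₁.within b π) (1 ^ℕ Inv π)) (permutations n) ℕ.* Q₁.∏⟨ b ⟩!
    ≡⟨ Q₁.inversions-within n b ∑b≡n ⟩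
  Q₁.⟨ n ⟩!
    ≡⟨ ⟨⟩!₁ n ⟩
  n !
    ∎
  where open ≡.≡-Reasoning

multinomial≡count-within : ∀ {a} n (b : Vec ℕ a) → Vec.sum b ≡ n → multinomial b ≡ count-within n b
multinomial≡count-within n b ≡.refl = ≡.trans
  (ℕ./-congˡ {{∏!≢0 b}} (≡.sym (count-within-* n b ≡.refl)))
  (ℕ.m*n/n≡m (count-within n b) (∏! b) {{∏!≢0 b}})

-- Ensures that `1/_` at this count is a true inverse and not the default value at 0.
count-within-nonZero : ∀ {a} n (b : Vec ℕ a) → Vec.sum b ≡ n → ℕ.NonZero (count-within n b)
count-within-nonZero n b ∑b≡n = ℕ.m*n≢0⇒m≢0 (count-within n b) {{≡.subst ℕ.NonZero (≡.sym (count-within-* n b ∑b≡n)) (n ℕ.!≢0)}}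

weakCompositions-sum : ∀ n a → All (λ b → Vec.sum b ≡ n) (weakCompositions n a)
weakCompositions-sum zero    zero    = ≡.refl ∷ []
weakCompositions-sum (suc n) zero    = []
weakCompositions-sum n       (suc a) =
  All.concat⁺ (All.map⁺ (All.applyUpTo⁺₁ _ (suc n) λ {b} b≤n →
    All.map⁺ (All.map (λ ∑bs≡ → ≡.trans (≡.cong (b ℕ.+_) ∑bs≡) (ℕ.m+[n∸m]≡n (s≤s⁻¹ b≤n)))
      (weakCompositions-sum (n ∸ b) a))))

module _ {c ℓ₁ ℓ₂ ℓ₃} (R : RealField c ℓ₁ ℓ₂ ℓ₃) where
  private
    module R where
      open RealField R public using (#⇒invertible; _^_; product; _·_)
      open CommutativeRing (RealField.commutativeRing R) public
      open HeytingProperties (RealField.heytingCommutativeRing R) public using (x-0≈x)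
      open ListSums (CommutativeRing.commutativeSemiring (RealField.commutativeRing R)) public

  1/-inverse : ∀ n → ℕ.NonZero n → (n R.· R.1#) R.* (1/_ R n) R.≈ R.1#
  1/-inverse (suc n) _ =
    R.trans (R.*-congʳ (R.sym (R.x-0≈x _))) (proj₂ (proj₂ (R.#⇒invertible _)))

  -- The multinomial coefficient in the cut probability equals the number of permutations among
  -- which one is chosen uniformly, so the two cancel.
  shuffleProbability-∑ : ∀ {n a} (p : Vector R.Carrier a) (π : Permutation′ n) →
    shuffleProbability R p π R.≈
    R.∑ᴸ (λ b → R.when (Q₁.within b π) (R.product λ i → p i R.^ Vec.lookup b i)) (weakCompositions n a)
  shuffleProbability-∑ {n} {a} p π = R.∑ᴸ-cong-All (All.map (λ {b} → weight≈ b) (weakCompositions-sum n a))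
    where
    weight≈ : ∀ b → Vec.sum b ≡ n →
      cutProbability R p b R.* uniform R (λ σ → descentsWithin? b (Perm.flip σ)) (permutations n) π R.≈
      R.when (Q₁.within b π) (R.product λ i → p i R.^ Vec.lookup b i)
    weight≈ b ∑b≡n = R.trans (R.*-when _ (Q₁.within b π) _) (R.when-cong {Q₁.within b π} ≡.refl (begin
      (multinomial b R.· R.1#) R.* P R.* 1/count    ≡⟨ ≡.cong (λ m → (m R.· R.1#) R.* P R.* 1/count) (multinomial≡count-within n b ∑b≡n) ⟩
      (count R.· R.1#) R.* P R.* 1/count            ≈⟨ xy∙z≈xz∙y _ _ _ ⟩
      (count R.· R.1#) R.* 1/count R.* P            ≈⟨ R.*-congʳ (1/-inverse count (count-within-nonZero n b ∑b≡n)) ⟩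
      R.1# R.* P                                    ≈⟨ R.*-identityˡ P ⟩
      P                                             ∎))
      where
      open SetoidReasoning R.setoid
      open import Algebra.Properties.CommutativeSemigroup R.*-commutativeSemigroup using (xy∙z≈xz∙y)
      P = R.product λ i → p i R.^ Vec.lookup b i
      count = count-within n b
      1/count = 1/_ R count

module _ {k ℓ} (K : CommutativeRing k ℓ) where
  open CommutativeRing K hiding (zero)
  open ListSums commutativeSemiring
  open import Algebra.Properties.Semiring.Exp semiring using (_^_)
  open import Algebra.Definitions.RawSemiring (RawRing.rawSemiring rawRing) using (product)
  open import Algebra.Properties.CommutativeMonoid.Sum *-commutativeMonoid public
    using () renaming (sum-cong-≋ to product-cong; ∑-distrib-+ to product-*)
  open import Algebra.Definitions.RawSemiring (RawRing.rawSemiring (powerSeries rawRing))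
    using () renaming (product to ∏ₛ)

  -- Products unfold at the first factor, while q-factorials grow at the last.
  product-last : ∀ n (f : ℕ → Carrier) →
                 product {suc n} (f ∘ toℕ) ≈ product {n} (f ∘ toℕ) * f n
  product-last zero    f = *-comm (f 0) 1#
  product-last (suc n) f = trans (*-congˡ (product-last n (f ∘ suc))) (sym (*-assoc _ _ _))

  module _ (q : Carrier) where
    open QCounting commutativeSemiring q using (⟨_⟩; ⟨_⟩!)

    sum-q^ : ∀ n → sum {n} (λ k → q ^ toℕ k) ≈ ⟨ n ⟩
    sum-q^ zero    = refl
    sum-q^ (suc n) = +-congˡ (trans (sym (*-distribˡ-sum {n} q (λ k → q ^ toℕ k))) (*-congˡ (sum-q^ n)))

    product-sum-q^ : ∀ n → product {n} (λ i → sum {suc (toℕ i)} λ k → q ^ toℕ k) ≈ ⟨ n ⟩!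
    product-sum-q^ zero    = refl
    product-sum-q^ (suc n) = begin
      product {suc n} (λ i → sum {suc (toℕ i)} λ k → q ^ toℕ k)
        ≈⟨ product-last n (λ i → sum {suc i} λ k → q ^ toℕ k) ⟩
      product {n} (λ i → sum {suc (toℕ i)} λ k → q ^ toℕ k) * sum {suc n} (λ k → q ^ toℕ k)
        ≈⟨ *-cong (product-sum-q^ n) (sum-q^ (suc n)) ⟩
      ⟨ n ⟩! * ⟨ suc n ⟩
        ≈⟨ *-comm _ _ ⟩
      ⟨ suc n ⟩! ∎
      where open SetoidReasoning setoid

  -- `weakCompositions` picks a first part k and continues with n ∸ k, exactly as the Cauchy product
  -- does.
  ∏ₛ-coefficient : ∀ {a} (F : Vector (PowerSeries rawRing) a) n →
    ∏ₛ F n ≈ ∑ᴸ (λ b → product λ i → F i (Vec.lookup b i)) (weakCompositions n a)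
  ∏ₛ-coefficient {zero}  F zero    = sym (+-identityʳ 1#)
  ∏ₛ-coefficient {zero}  F (suc n) = refl
  ∏ₛ-coefficient {suc a} F n       = begin
    sum {suc n} (λ k → F zero (toℕ k) * ∏ₛ (F ∘ suc) (n ∸ toℕ k))
      ≈⟨ sum-cong-≋ {suc n} (λ k → trans
           (*-congˡ (∏ₛ-coefficient (F ∘ suc) (n ∸ toℕ k)))
           (*-distribˡ-∑ᴸ (F zero (toℕ k)) _ (weakCompositions (n ∸ toℕ k) a))) ⟩
    sum {suc n} (λ k → ∑ᴸ (λ b → term (toℕ k ∷ b)) (weakCompositions (n ∸ toℕ k) a))
      ≡⟨ ∑ᴸ-applyUpTo (λ k → ∑ᴸ (λ b → term (k ∷ b)) (weakCompositions (n ∸ k) a)) (λ k → k) (suc n) ⟨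
    ∑ᴸ (λ k → ∑ᴸ (λ b → term (k ∷ b)) (weakCompositions (n ∸ k) a)) (upTo (suc n))
      ≈⟨ ∑ᴸ-cong (λ k → reflexive (∑ᴸ-map term (k ∷_) (weakCompositions (n ∸ k) a))) (upTo (suc n)) ⟨
    ∑ᴸ (λ k → ∑ᴸ term (List.map (k ∷_) (weakCompositions (n ∸ k) a))) (upTo (suc n))
      ≈⟨ ∑ᴸ-concatMap term (λ k → List.map (k ∷_) (weakCompositions (n ∸ k) a)) (upTo (suc n)) ⟨
    ∑ᴸ term (weakCompositions n (suc a))
      ∎
    where
    open SetoidReasoning setoid
    term : Vec ℕ (suc a) → Carrier
    term b = product λ i → F i (Vec.lookup b i)

module _ {c ℓ₁ ℓ₂ ℓ₃ k ℓ} (R : RealField c ℓ₁ ℓ₂ ℓ₃) (K : CommutativeRing k ℓ) where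
  private
    module R where
      open RealField R public using (_^_; product)
      open CommutativeRing (RealField.commutativeRing R) public
      open ListSums (CommutativeRing.commutativeSemiring (RealField.commutativeRing R)) public
    open CommutativeRing K hiding (zero)
    open ListSums commutativeSemiring
    open import Algebra.Properties.Semiring.Exp semiring using (_^_)
    open import Algebra.Definitions.RawSemiring (RawRing.rawSemiring rawRing) using (product)

  module _ (ι : R.Carrier → Carrier)
           (ι-isHomomorphism : SemiringMorphisms.IsSemiringHomomorphism
             (RawRing.rawSemiring R.rawRing) (RawRing.rawSemiring rawRing) ι)
           (q : Carrier) where
    private
      open Generating R rawRing ι q
      open SemiringMorphisms.IsSemiringHomomorphism ι-isHomomorphism
      open QCounting commutativeSemiring q
      open SetoidReasoning setoid

      ι-∑ᴸ : ∀ {a} {A : Set a} (f : A → R.Carrier) xs → ι (R.∑ᴸ f xs) ≈ ∑ᴸ (ι ∘ f) xs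
      ι-∑ᴸ f []       = 0#-homo
      ι-∑ᴸ f (x ∷ xs) = trans (+-homo _ _) (+-congˡ (ι-∑ᴸ f xs))

      ι-when : ∀ b x → ι (R.when b x) ≈ when b (ι x)
      ι-when false x = 0#-homo
      ι-when true  x = refl

      ι-^ : ∀ x n → ι (x R.^ n) ≈ ι x ^ n
      ι-^ x zero    = 1#-homo
      ι-^ x (suc n) = trans (*-homo _ _) (*-congˡ (ι-^ x n))

      ι-product : ∀ {n} (f : Vector R.Carrier n) → ι (R.product f) ≈ product (ι ∘ f)
      ι-product {zero}  f = 1#-homo
      ι-product {suc n} f = trans (*-homo _ _) (*-congˡ (ι-product (f ∘ suc)))

    module _ {a} (p : Vector R.Carrier a) where
      private
        monomial : Vec ℕ a → Carrier
        monomial b = product λ i → ι (p i) ^ Vec.lookup b i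

        inversions : ℕ → Vec ℕ a → Carrier
        inversions n b = ∑ᴸ (λ π → when (within b π) (q ^ Inv π)) (permutations n)

      -- Exchanging the sums over π and b sorts the expectation by cut sizes.
      expectation-∑ : ∀ n → expectation n p (λ π → q ^ Inv π) ≈
                      ∑ᴸ (λ b → monomial b * inversions n b) (weakCompositions n a)
      expectation-∑ n = begin
        ∑ᴸ (λ π → ι (shuffleProbability R p π) * q ^ Inv π) (permutations n)
          ≈⟨ ∑ᴸ-cong (λ π → trans
               (*-congʳ (trans (⟦⟧-cong (shuffleProbability-∑ R p π)) (ι-∑ᴸ _ (weakCompositions n a))))
               (*-distribʳ-∑ᴸ (q ^ Inv π) _ (weakCompositions n a))) (permutations n) ⟩
        ∑ᴸ (λ π → ∑ᴸ (λ b → ι (R.when (within b π) (R.product λ i → p i R.^ Vec.lookup b i)) * q ^ Inv π)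
                     (weakCompositions n a)) (permutations n)
          ≈⟨ ∑ᴸ-cong (λ π → ∑ᴸ-cong (λ b → ι-term b π) (weakCompositions n a)) (permutations n) ⟩
        ∑ᴸ (λ π → ∑ᴸ (λ b → monomial b * when (within b π) (q ^ Inv π)) (weakCompositions n a)) (permutations n)
          ≈⟨ ∑ᴸ-comm _ (permutations n) (weakCompositions n a) ⟩
        ∑ᴸ (λ b → ∑ᴸ (λ π → monomial b * when (within b π) (q ^ Inv π)) (permutations n)) (weakCompositions n a)
          ≈⟨ ∑ᴸ-cong (λ b → *-distribˡ-∑ᴸ (monomial b) _ (permutations n)) (weakCompositions n a) ⟨
        ∑ᴸ (λ b → monomial b * inversions n b) (weakCompositions n a)
          ∎
        where
        ι-term : ∀ b (π : Permutation′ n) →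
                 ι (R.when (within b π) (R.product λ i → p i R.^ Vec.lookup b i)) * q ^ Inv π ≈
                 monomial b * when (within b π) (q ^ Inv π)
        ι-term b π = begin
          ι (R.when (within b π) (R.product λ i → p i R.^ Vec.lookup b i)) * q ^ Inv π
            ≈⟨ *-congʳ (trans (ι-when (within b π) _) (when-cong {within b π} ≡.refl
                 (trans (ι-product λ i → p i R.^ Vec.lookup b i) (product-cong K λ i → ι-^ (p i) (Vec.lookup b i))))) ⟩
          when (within b π) (monomial b) * q ^ Inv π   ≈⟨ *-comm _ _ ⟩
          q ^ Inv π * when (within b π) (monomial b)   ≈⟨ *-when _ (within b π) _ ⟩
          when (within b π) (q ^ Inv π * monomial b)   ≈⟨ when-cong {within b π} ≡.refl (*-comm _ _) ⟩
          when (within b π) (monomial b * q ^ Inv π)   ≈⟨ *-when _ (within b π) _ ⟨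
          monomial b * when (within b π) (q ^ Inv π)   ∎

      module _ (1/! : FactorialsInvertible) where
        private
          e : ℕ → Carrier
          e n = proj₁ (1/! n)

          e-inverse : ∀ n → e n * ⟨ n ⟩! ≈ 1#
          e-inverse n = trans (*-congˡ (sym (product-sum-q^ K q n))) (proj₁ (proj₂ (1/! n)))

          ∏e : ∀ {a} → Vec ℕ a → Carrier
          ∏e b = product λ i → e (Vec.lookup b i)

          ∏e-inverse : ∀ {a} (b : Vec ℕ a) → ∏e b * ∏⟨ b ⟩! ≈ 1#
          ∏e-inverse []       = *-identityˡ 1#
          ∏e-inverse (b ∷ bs) = trans (interchange _ _ _ _)
            (trans (*-cong (e-inverse b) (∏e-inverse bs)) (*-identityˡ 1#))
            where open import Algebra.Properties.CommutativeSemigroup *-commutativeSemigroup using (interchange)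

          -- Inserting `∏e b * ∏⟨ b ⟩!`, which is 1, produces the product that `inversions-within`
          -- evaluates to `⟨ n ⟩!`, and this cancels against `e n`.
          e*inversions : ∀ n b → Vec.sum b ≡ n → e n * inversions n b ≈ ∏e b
          e*inversions n b ∑b≡n = begin
            e n * inversions n b                            ≈⟨ *-identityʳ _ ⟨
            e n * inversions n b * 1#                       ≈⟨ *-congˡ (∏e-inverse b) ⟨
            e n * inversions n b * (∏e b * ∏⟨ b ⟩!)         ≈⟨ *-congˡ (*-comm _ _) ⟩
            e n * inversions n b * (∏⟨ b ⟩! * ∏e b)         ≈⟨ *-assoc _ _ _ ⟨
            e n * inversions n b * ∏⟨ b ⟩! * ∏e b           ≈⟨ *-congʳ (*-assoc _ _ _) ⟩
            e n * (inversions n b * ∏⟨ b ⟩!) * ∏e b         ≈⟨ *-congʳ (*-congˡ (inversions-within n b ∑b≡n)) ⟩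
            e n * ⟨ n ⟩! * ∏e b                             ≈⟨ *-congʳ (e-inverse n) ⟩
            1# * ∏e b                                       ≈⟨ *-identityˡ _ ⟩
            ∏e b                                            ∎

        inversionSeries≈∏qExponential : inversionSeries 1/! p ≈ₛ ∏ₛ λ i → qExponential 1/! (p i)
        inversionSeries≈∏qExponential n = begin
          e n * expectation n p (λ π → q ^ Inv π)
            ≈⟨ *-congˡ (expectation-∑ n) ⟩
          e n * ∑ᴸ (λ b → monomial b * inversions n b) (weakCompositions n a)
            ≈⟨ *-distribˡ-∑ᴸ (e n) _ (weakCompositions n a) ⟩
          ∑ᴸ (λ b → e n * (monomial b * inversions n b)) (weakCompositions n a)
            ≈⟨ ∑ᴸ-cong-All (All.map (λ {b} → term b) (weakCompositions-sum n a)) ⟩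
          ∑ᴸ (λ b → product λ i → qExponential 1/! (p i) (Vec.lookup b i)) (weakCompositions n a)
            ≈⟨ ∏ₛ-coefficient K (λ i → qExponential 1/! (p i)) n ⟨
          ∏ₛ (λ i → qExponential 1/! (p i)) n
            ∎
          where
          open import Algebra.Properties.CommutativeSemigroup *-commutativeSemigroup using (x∙yz≈y∙xz)
          term : ∀ b → Vec.sum b ≡ n → e n * (monomial b * inversions n b) ≈
                 product λ i → qExponential 1/! (p i) (Vec.lookup b i)
          term b ∑b≡n = begin
            e n * (monomial b * inversions n b)   ≈⟨ x∙yz≈y∙xz _ _ _ ⟩
            monomial b * (e n * inversions n b)   ≈⟨ *-congˡ (e*inversions n b ∑b≡n) ⟩
            monomial b * ∏e b                     ≈⟨ product-* K (λ i → ι (p i) ^ Vec.lookup b i) (λ i → e (Vec.lookup b i)) ⟨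
            product (λ i → qExponential 1/! (p i) (Vec.lookup b i)) ∎

-- Units

module Units {k ℓ} (K : CommutativeRing k ℓ) where
  open CommutativeRing K hiding (zero)
  open import Algebra.Definitions.RawSemiring (RawRing.rawSemiring rawRing) using (product; _^_)
  open import Algebra.Properties.CommutativeMonoid *-commutativeMonoid public
    using (invertibleˡ⇒invertible)
  open import Algebra.Properties.CommutativeSemigroup *-commutativeSemigroup using (interchange)

  Unit : Carrier → Set _
  Unit = Invertible _≈_ 1# _*_

  unit-resp : ∀ {x y} → x ≈ y → Unit x → Unit y
  unit-resp x≈y (t , tx≈1 , _) = invertibleˡ⇒invertible (t , trans (*-congˡ (sym x≈y)) tx≈1)

  unit-1 : Unit 1#
  unit-1 = invertibleˡ⇒invertible (1# , *-identityˡ 1#)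

  unit-* : ∀ {x y} → Unit x → Unit y → Unit (x * y)
  unit-* (s , sx≈1 , _) (t , ty≈1 , _) = invertibleˡ⇒invertible
    (s * t , trans (interchange _ _ _ _) (trans (*-cong sx≈1 ty≈1) (*-identityˡ 1#)))

  unit-*⁻ʳ : ∀ {x y} → Unit (x * y) → Unit y
  unit-*⁻ʳ {x} {y} (t , txy≈1 , _) = invertibleˡ⇒invertible (t * x , trans (*-assoc t x y) txy≈1)

  unit-product : ∀ {n} {f : Vector Carrier n} → (∀ i → Unit (f i)) → Unit (product f)
  unit-product {zero}  unit = unit-1
  unit-product {suc n} unit = unit-* (unit zero) (unit-product (unit ∘ suc))

  unit-^ : ∀ {x} → Unit x → ∀ n → Unit (x ^ n)
  unit-^ unit zero    = unit-1
  unit-^ unit (suc n) = unit-* unit (unit-^ unit n)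

-- Embedding of the reals in ℝ(q) and invertibility of [n]! there

module PolynomialFractions {c ℓ₁ ℓ₂ ℓ₃} (R : RealField c ℓ₁ ℓ₂ ℓ₃) where
  open Polynomials R
  open RationalFunctions R
  open Units rationalFunctionField
  private
    module R where
      open HeytingProperties (RealField.heytingCommutativeRing R) public using (1#0)
      open CommutativeRing (RealField.commutativeRing R) public
    open CommutativeRing polynomialRing using (_≈_; refl; sym; trans; +-congˡ; *-cong; *-identityˡ)
    open IntegerSolver polynomialRing
    module Q = CommutativeRing rationalFunctionField

  module _ where
    open SemiringMorphisms (RawRing.rawSemiring (CommutativeRing.rawRing polynomialRing))
                           (RawRing.rawSemiring Q.rawRing)

    polynomial-isHomomorphism : IsSemiringHomomorphism (polynomial R)
    polynomial-isHomomorphism = record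
      { isNearSemiringHomomorphism = record
        { +-isMonoidHomomorphism = record
          { isMagmaHomomorphism = record
            { isRelHomomorphism = record { cong = λ f≋g → *-cong f≋g refl .at }
            ; homo = λ f g → solve 2 (λ f g → (f :+ g) :* (𝟙 :* 𝟙) := (f :* 𝟙 :+ g :* 𝟙) :* 𝟙) refl f g .at
            }
          ; ε-homo = Q.refl {Q.0#}
          }
        ; *-homo = λ f g → solve 2 (λ f g → (f :* g) :* (𝟙 :* 𝟙) := (f :* g) :* 𝟙) refl f g .at
        }
      ; 1#-homo = Q.refl {Q.1#}
      }

  module _ where
    open SemiringMorphisms (RawRing.rawSemiring R.rawRing)
                           (RawRing.rawSemiring (CommutativeRing.rawRing polynomialRing))

    singleton-isHomomorphism : IsSemiringHomomorphism (_∷ [])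
    singleton-isHomomorphism = record
      { isNearSemiringHomomorphism = record
        { +-isMonoidHomomorphism = record
          { isMagmaHomomorphism = record
            { isRelHomomorphism = record
              { cong = λ x≈y → coefficientwise λ { zero → x≈y ; (suc _) → R.refl } }
            ; homo = λ x y → refl
            }
          ; ε-homo = coefficientwise λ { zero → R.refl ; (suc _) → R.refl }
          }
        ; *-homo = λ x y → coefficientwise λ { zero → R.sym (R.+-identityʳ _) ; (suc _) → R.refl }
        }
      ; 1#-homo = refl
      }

  constant-isHomomorphism :
    SemiringMorphisms.IsSemiringHomomorphism (RawRing.rawSemiring R.rawRing)
      (RawRing.rawSemiring Q.rawRing) (constant R)
  constant-isHomomorphism = Composition.isSemiringHomomorphism (λ {x} {y} {z} → Q.trans {x} {y} {z})
    singleton-isHomomorphism polynomial-isHomomorphism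

  polynomial-unit : ∀ f → NonZeroₚ R f → Unit (polynomial R f)
  polynomial-unit f f≠0 = invertibleˡ⇒invertible
    {polynomial R f} ((R.1# ∷ []) / f [ f≠0 ] , solve 1 (λ f → (𝟙 :* f) :* 𝟙 := 𝟙 :* (f :* 𝟙)) refl f .at)

  open Generating R Q.rawRing (constant R) (indeterminate R)
  open import Algebra.Definitions.RawSemiring (RawRing.rawSemiring Q.rawRing) using (_^_; sum)

  -- The factor [n + 1] is the polynomial with n + 1 coefficients 1. Its constant coefficient is
  -- apart from 0, so it may serve as a denominator.
  factorialsInvertible : FactorialsInvertible
  factorialsInvertible n = unit-product {n} λ i → geometric-unit (toℕ i)
    where
    q = indeterminate R
    open QCounting Q.commutativeSemiring q using (⟨_⟩)
    open SemiringMorphisms.IsSemiringHomomorphism polynomial-isHomomorphism using (⟦⟧-cong; +-homo; *-homo)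

    ones : ℕ → Polynomial R
    ones n = List.replicate n R.1#

    1+q*ones : ∀ n → (R.1# ∷ []) ⊕ (R.0# ∷ R.1# ∷ []) ⊗ ones n ≈ ones (suc n)
    1+q*ones n = trans
      (+-congˡ {R.1# ∷ []} (trans (shift-⊗ (R.1# ∷ []) (ones n)) (∷-cong R.refl (*-identityˡ (ones n)))))
      (∷-cong (R.+-identityʳ R.1#) refl)

    ⟨⟩≈ones : ∀ n → ⟨ n ⟩ Q.≈ polynomial R (ones n)
    ⟨⟩≈ones zero    = Q.refl {Q.0#}
    ⟨⟩≈ones (suc n) = begin
      Q.1# Q.+ q Q.* ⟨ n ⟩
        ≈⟨ Q.+-congˡ {Q.1#} {q Q.* ⟨ n ⟩} {q Q.* polynomial R (ones n)}
             (Q.*-congˡ {q} {⟨ n ⟩} {polynomial R (ones n)} (⟨⟩≈ones n)) ⟩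
      Q.1# Q.+ q Q.* polynomial R (ones n)
        ≈⟨ Q.+-congˡ {Q.1#} {polynomial R ((R.0# ∷ R.1# ∷ []) ⊗ ones n)} {q Q.* polynomial R (ones n)}
             (*-homo (R.0# ∷ R.1# ∷ []) (ones n)) ⟨
      Q.1# Q.+ polynomial R ((R.0# ∷ R.1# ∷ []) ⊗ ones n)
        ≈⟨ +-homo (R.1# ∷ []) ((R.0# ∷ R.1# ∷ []) ⊗ ones n) ⟨
      polynomial R ((R.1# ∷ []) ⊕ (R.0# ∷ R.1# ∷ []) ⊗ ones n)
        ≈⟨ ⟦⟧-cong {(R.1# ∷ []) ⊕ (R.0# ∷ R.1# ∷ []) ⊗ ones n} (1+q*ones n) ⟩
      polynomial R (ones (suc n))
        ∎
      where open SetoidReasoning Q.setoid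

    geometric-unit : ∀ n → Unit (sum {suc n} λ k → q ^ toℕ k)
    geometric-unit n = unit-resp {polynomial R (ones (suc n))} {sum {suc n} λ k → q ^ toℕ k}
      (Q.sym {sum {suc n} λ k → q ^ toℕ k} {polynomial R (ones (suc n))}
        (Q.trans {sum {suc n} λ k → q ^ toℕ k} {⟨ suc n ⟩} {polynomial R (ones (suc n))}
          (sum-q^ rationalFunctionField q (suc n)) (⟨⟩≈ones (suc n))))
      (polynomial-unit (ones (suc n)) (0 , R.1#0))

-- The q-binomial theorem

module QBinomial {k ℓ} (K : CommutativeRing k ℓ) where
  open CommutativeRing K hiding (zero)
  open IntegerSolver K
  open ListSums commutativeSemiring using (sum; sum-cong-≋; sum-replicate-zero; *-distribˡ-sum)
  open import Algebra.Properties.CommutativeSemiring.Exp commutativeSemiring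
    using (_^_; ^-congʳ; ^-homo-*; ^-distrib-*)
  open import Algebra.Definitions.RawSemiring (RawRing.rawSemiring rawRing) using (product)
  open RawRing (powerSeries rawRing) using ()
    renaming (_≈_ to _≈ₛ_; _+_ to _+ₛ_; _*_ to _*ₛ_; -_ to -ₛ_; 1# to 1ₛ)
  open import Algebra.Definitions.RawSemiring (RawRing.rawSemiring (powerSeries rawRing))
    using () renaming (product to ∏ₛ)
  open SetoidReasoning setoid

  geometric : Carrier → PowerSeries rawRing
  geometric x n = x ^ n

  -- The geometric series is 1 / (1 - x u), so g = f / (1 - x u) satisfies g = x u g + f.
  geometric-*-suc : ∀ x f n → (geometric x *ₛ f) (suc n) ≈ x * (geometric x *ₛ f) n + f (suc n)
  geometric-*-suc x f n = begin
    1# * f (suc n) + sum {suc n} (λ k → x * x ^ toℕ k * f (n ∸ toℕ k))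
      ≈⟨ +-cong (*-identityˡ _) (trans
           (sum-cong-≋ {suc n} λ k → *-assoc x (x ^ toℕ k) (f (n ∸ toℕ k)))
           (sym (*-distribˡ-sum {suc n} x (λ k → x ^ toℕ k * f (n ∸ toℕ k))))) ⟩
    f (suc n) + x * (geometric x *ₛ f) n
      ≈⟨ +-comm _ _ ⟩
    x * (geometric x *ₛ f) n + f (suc n)
      ∎

  module _ (x : Carrier) where
    private
      1-xu : PowerSeries rawRing
      1-xu = 1ₛ +ₛ (-ₛ (_·u rawRing x))

    geometric-inverseˡ : geometric x *ₛ 1-xu ≈ₛ 1ₛ
    geometric-inverseˡ zero = solve 0 (𝟙 :* (𝟙 :- 𝟘) :+ 𝟘 := 𝟙) refl
    geometric-inverseˡ (suc n) = trans (geometric-*-suc x 1-xu n) (trans (+-congʳ (*-congˡ (geometric-inverseˡ n))) (step n))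
      where
      step : ∀ n → x * 1ₛ n + 1-xu (suc n) ≈ 0#
      step zero    = solve 1 (λ x → x :* 𝟙 :+ (𝟘 :- x) := 𝟘) refl x
      step (suc n) = solve 1 (λ x → x :* 𝟘 :+ (𝟘 :- 𝟘) := 𝟘) refl x

    geometric-inverseʳ : 1-xu *ₛ geometric x ≈ₛ 1ₛ
    geometric-inverseʳ zero    = solve 0 ((𝟙 :- 𝟘) :* 𝟙 :+ 𝟘 := 𝟙) refl
    geometric-inverseʳ (suc n) = begin
      (1# - 0#) * (x * x ^ n) + ((0# - x) * x ^ n + sum {n} (λ k → (0# - 0#) * x ^ (n ∸ suc (toℕ k))))
        ≈⟨ +-congˡ (+-congˡ (trans
             (sum-cong-≋ {n} λ k → trans (*-congʳ (-‿inverseʳ 0#)) (zeroˡ _))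
             (sum-replicate-zero n))) ⟩
      (1# - 0#) * (x * x ^ n) + ((0# - x) * x ^ n + 0#)
        ≈⟨ solve 2 (λ x y → (𝟙 :- 𝟘) :* (x :* y) :+ ((𝟘 :- x) :* y :+ 𝟘) := 𝟘) refl x (x ^ n) ⟩
      0#
        ∎

  module _ (q : Carrier) where
    open QCounting commutativeSemiring q using (⟨_⟩; ⟨_⟩!)

    -- The q-Pochhammer symbol (qʲ; q)ₙ.
    shiftedFactorial : ℕ → ℕ → Carrier
    shiftedFactorial j n = product {n} λ i → 1# - q ^ (j ℕ.+ toℕ i)

    shiftedFactorial-first : ∀ j n → shiftedFactorial j (suc n) ≈ (1# - q ^ j) * shiftedFactorial (suc j) n
    shiftedFactorial-first j n = *-cong
      (+-congˡ (-‿cong (^-congʳ q (ℕ.+-identityʳ j))))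
      (product-cong K {n} λ i → +-congˡ (-‿cong (^-congʳ q (ℕ.+-suc j (toℕ i)))))

    shiftedFactorial-last : ∀ j n → shiftedFactorial j (suc n) ≈ shiftedFactorial j n * (1# - q ^ (j ℕ.+ n))
    shiftedFactorial-last j n = product-last K n (λ i → 1# - q ^ (j ℕ.+ i))

    -- The q-binomial theorem for 1 / (1 - c qʲ u) with j < J, multiplied by (q; q)ₙ. Removing the
    -- factor j = 0 replaces c by c q, so c must vary in the induction on J; d is specified only up
    -- to ≈ because c q · qʲ and c · qʲ⁺¹ are different terms. An inner induction on n uses
    -- `geometric-*-suc`.
    ∏-geometric : ∀ J c (d : Fin J → Carrier) → (∀ j → d j ≈ c * q ^ toℕ j) → ∀ n →
                  ∏ₛ (λ j → geometric (d j)) n * shiftedFactorial 1 n ≈ c ^ n * shiftedFactorial J n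
    ∏-geometric zero    c d d≈ zero    = refl
    -- The empty product is the series 1, and (q⁰; q)ₙ₊₁ vanishes through its factor 1 - q⁰.
    ∏-geometric zero    c d d≈ (suc n) = begin
      0# * shiftedFactorial 1 (suc n)                   ≈⟨ zeroˡ _ ⟩
      0#                                                ≈⟨ solve 2 (λ x y → 𝟘 := x :* ((𝟙 :- 𝟙) :* y)) refl _ _ ⟩
      c ^ suc n * ((1# - 1#) * shiftedFactorial 1 n)    ≈⟨ *-congˡ (shiftedFactorial-first 0 n) ⟨
      c ^ suc n * shiftedFactorial 0 (suc n)            ∎
    ∏-geometric (suc J) c d d≈ n = coefficient≈ n
      where
      tail : PowerSeries rawRing
      tail = ∏ₛ λ j → geometric (d (suc j))

      tail≈ : ∀ n → tail n * shiftedFactorial 1 n ≈ (c * q) ^ n * shiftedFactorial J n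
      tail≈ = ∏-geometric J (c * q) (d ∘ suc) λ j → trans (d≈ (suc j)) (sym (*-assoc c q _))

      coefficient≈ : ∀ n → (geometric (d zero) *ₛ tail) n * shiftedFactorial 1 n ≈
                           c ^ n * shiftedFactorial (suc J) n
      coefficient≈ zero    = begin
        (1# * tail 0 + 0#) * 1#    ≈⟨ *-congʳ (trans (+-identityʳ _) (*-identityˡ _)) ⟩
        tail 0 * 1#                ≈⟨ tail≈ 0 ⟩
        1# * 1#                    ∎
      coefficient≈ (suc n) = begin
        (geometric (d zero) *ₛ tail) (suc n) * shiftedFactorial 1 (suc n)
          ≈⟨ *-congʳ (geometric-*-suc (d zero) tail n) ⟩
        (d zero * p + tail (suc n)) * shiftedFactorial 1 (suc n)
          ≈⟨ distribʳ _ _ _ ⟩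
        d zero * p * shiftedFactorial 1 (suc n) + tail (suc n) * shiftedFactorial 1 (suc n)
          ≈⟨ +-cong (*-cong (*-congʳ (trans (d≈ zero) (*-identityʳ c))) (shiftedFactorial-last 1 n)) (tail≈ (suc n)) ⟩
        c * p * (shiftedFactorial 1 n * (1# - q ^ suc n)) + (c * q) ^ suc n * shiftedFactorial J (suc n)
          ≈⟨ +-cong
               (solve 4 (λ c p s r → c :* p :* (s :* r) := c :* (p :* s) :* r) refl c p _ _)
               (*-cong (^-distrib-* c q (suc n)) (shiftedFactorial-first J n)) ⟩
        c * (p * shiftedFactorial 1 n) * (1# - q ^ suc n) + c ^ suc n * q ^ suc n * ((1# - q ^ J) * s)
          ≈⟨ +-congʳ (*-congʳ (*-congˡ (coefficient≈ n))) ⟩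
        c * (c ^ n * s) * (1# - q ^ suc n) + c ^ suc n * q ^ suc n * ((1# - q ^ J) * s)
          -- With r = qⁿ⁺¹ and y = qᴶ this is (1 - r) + r (1 - y) = 1 - y r.
          ≈⟨ solve 5 (λ c cⁿ s r y → c :* (cⁿ :* s) :* (𝟙 :- r) :+ c :* cⁿ :* r :* ((𝟙 :- y) :* s)
               := c :* cⁿ :* (s :* (𝟙 :- y :* r))) refl c (c ^ n) s (q ^ suc n) (q ^ J) ⟩
        c ^ suc n * (s * (1# - q ^ J * q ^ suc n))
          ≈⟨ *-congˡ (*-congˡ (+-congˡ (-‿cong (trans (sym (^-homo-* q J (suc n))) (^-congʳ q (ℕ.+-suc J n)))))) ⟩
        c ^ suc n * (s * (1# - q ^ (suc J ℕ.+ n)))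
          ≈⟨ *-congˡ (shiftedFactorial-last (suc J) n) ⟨
        c ^ suc n * shiftedFactorial (suc J) (suc n)
          ∎
        where
        p = (geometric (d zero) *ₛ tail) n
        s = shiftedFactorial (suc J) n

    1-q^ : ∀ n → 1# - q ^ n ≈ (1# - q) * ⟨ n ⟩
    1-q^ zero    = solve 1 (λ q → 𝟙 :- 𝟙 := (𝟙 :- q) :* 𝟘) refl q
    1-q^ (suc n) = begin
      1# - q * q ^ n                        ≈⟨ solve 2 (λ q r → 𝟙 :- q :* r := (𝟙 :- q) :+ q :* (𝟙 :- r)) refl q (q ^ n) ⟩
      (1# - q) + q * (1# - q ^ n)           ≈⟨ +-congˡ (*-congˡ (1-q^ n)) ⟩
      (1# - q) + q * ((1# - q) * ⟨ n ⟩)     ≈⟨ solve 2 (λ q m → (𝟙 :- q) :+ q :* ((𝟙 :- q) :* m) := (𝟙 :- q) :* (𝟙 :+ q :* m)) refl q ⟨ n ⟩ ⟩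
      (1# - q) * (1# + q * ⟨ n ⟩)           ∎

    shiftedFactorial-1 : ∀ n → shiftedFactorial 1 n ≈ (1# - q) ^ n * ⟨ n ⟩!
    shiftedFactorial-1 zero    = sym (*-identityˡ 1#)
    shiftedFactorial-1 (suc n) = begin
      shiftedFactorial 1 (suc n)                           ≈⟨ shiftedFactorial-last 1 n ⟩
      shiftedFactorial 1 n * (1# - q ^ suc n)              ≈⟨ *-cong (shiftedFactorial-1 n) (1-q^ (suc n)) ⟩
      (1# - q) ^ n * ⟨ n ⟩! * ((1# - q) * ⟨ suc n ⟩)       ≈⟨ solve 4 (λ a b c d → a :* b :* (c :* d) := c :* a :* (d :* b)) refl _ _ _ _ ⟩
      (1# - q) ^ suc n * ⟨ suc n ⟩!                        ∎

    -- For c = x (1 - q) the factor (1 - q)ⁿ in cⁿ cancels against the one in (q; q)ₙ = (1 - q)ⁿ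
    -- [n]!; t is its inverse and e that of [n]!.
    ∏-geometric-coefficient : Units.Unit K (1# - q) → ∀ J n x e → e * ⟨ n ⟩! ≈ 1# →
      ∏ₛ {J} (λ j → geometric (x * (1# - q) * q ^ toℕ j)) n ≈ x ^ n * e * shiftedFactorial J n
    ∏-geometric-coefficient 1-q-unit J n x e e*n!≈1 = begin
      p                                                            ≈⟨ solve 1 (λ p → p := p :* (𝟙 :* 𝟙)) refl p ⟩
      p * (1# * 1#)                                                ≈⟨ *-congˡ (*-cong t*[1-q]^n≈1 e*n!≈1) ⟨
      p * (t * (1# - q) ^ n * (e * ⟨ n ⟩!))                        ≈⟨ solve 5 (λ p t r e m → p :* (t :* r :* (e :* m)) := t :* e :* (p :* (r :* m))) refl _ _ _ _ _ ⟩
      t * e * (p * ((1# - q) ^ n * ⟨ n ⟩!))                        ≈⟨ *-congˡ (*-congˡ (shiftedFactorial-1 n)) ⟨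
      t * e * (p * shiftedFactorial 1 n)                           ≈⟨ *-congˡ (∏-geometric J (x * (1# - q)) _ (λ _ → refl) n) ⟩
      t * e * ((x * (1# - q)) ^ n * shiftedFactorial J n)          ≈⟨ *-congˡ (*-congʳ (^-distrib-* x (1# - q) n)) ⟩
      t * e * (x ^ n * (1# - q) ^ n * shiftedFactorial J n)        ≈⟨ solve 5 (λ t e y r s → t :* e :* (y :* r :* s) := t :* r :* (y :* e :* s)) refl _ _ _ _ _ ⟩
      t * (1# - q) ^ n * (x ^ n * e * shiftedFactorial J n)        ≈⟨ *-congʳ t*[1-q]^n≈1 ⟩
      1# * (x ^ n * e * shiftedFactorial J n)                      ≈⟨ *-identityˡ _ ⟩
      x ^ n * e * shiftedFactorial J n                             ∎
      where
      p = ∏ₛ {J} (λ j → geometric (x * (1# - q) * q ^ toℕ j)) n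
      [1-q]^n-unit = Units.unit-^ K 1-q-unit n
      t = proj₁ [1-q]^n-unit
      t*[1-q]^n≈1 = proj₁ (proj₂ [1-q]^n-unit)

-- Ordered fields

module OrderedField {c ℓ₁ ℓ₂ ℓ₃} (R : RealField c ℓ₁ ℓ₂ ℓ₃) where
  open RealField R using (_#_; _<_; <-irrefl; <-trans; <-resp-≈; <-cotrans; #⇔<⊎>; 0<1; +-mono-<; *-pos; archimedean; #⇒invertible; heytingCommutativeRing) public
  open CommutativeRing (RealField.commutativeRing R) hiding (zero)
  open IntegerSolver (RealField.commutativeRing R)
  open HeytingProperties heytingCommutativeRing using (x-0≈x; invertibleˡ⇒#; #-congʳ)
  open import Algebra.Definitions.RawSemiring (RawRing.rawSemiring rawRing) using (_^_) renaming (_×_ to _·_)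
  open import Algebra.Properties.Semiring.Mult semiring using (×-homo-+)

  Positive NonNegative : Carrier → Set _
  Positive    x = 0# < x
  NonNegative x = ¬ (x < 0#)

  <-respˡ : ∀ {x y z} → x ≈ y → x < z → y < z
  <-respˡ = proj₂ <-resp-≈

  <-respʳ : ∀ {x y z} → y ≈ z → x < y → x < z
  <-respʳ = proj₁ <-resp-≈

  x<y⇒0<y-x : ∀ {x y} → x < y → Positive (y - x)
  x<y⇒0<y-x {x} x<y = <-respˡ (-‿inverseʳ x) (+-mono-< (- x) x<y)

  0<y-x⇒x<y : ∀ {x y} → Positive (y - x) → x < y
  0<y-x⇒x<y {x} {y} 0<y-x = <-respˡ (+-identityˡ x)
    (<-respʳ (solve 2 (λ x y → y :- x :+ x := y) refl x y) (+-mono-< x 0<y-x))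

  nonNegative-resp : ∀ {x y} → x ≈ y → NonNegative x → NonNegative y
  nonNegative-resp x≈y 0≤x y<0 = 0≤x (<-respˡ (sym x≈y) y<0)

  positive⇒nonNegative : ∀ {x} → Positive x → NonNegative x
  positive⇒nonNegative 0<x x<0 = <-irrefl refl (<-trans 0<x x<0)

  nonNegative-0 : NonNegative 0#
  nonNegative-0 = <-irrefl refl

  nonNegative-+ : ∀ {x y} → NonNegative x → NonNegative y → NonNegative (x + y)
  nonNegative-+ {x} {y} 0≤x 0≤y x+y<0 with <-cotrans x+y<0 y
  ... | inj₂ y<0   = 0≤y y<0
  ... | inj₁ x+y<y = 0≤x (<-respˡ (solve 2 (λ x y → x :+ y :- y := x) refl x y)
    (<-respʳ (-‿inverseʳ y) (+-mono-< (- y) x+y<y)))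

  positive-+ : ∀ {x y} → Positive x → NonNegative y → Positive (x + y)
  positive-+ {x} {y} 0<x 0≤y with <-cotrans (<-respˡ (+-identityˡ y) (+-mono-< y 0<x)) 0#
  ... | inj₁ y<0   = contradiction y<0 0≤y
  ... | inj₂ 0<x+y = 0<x+y

  x<0⇒0<-x : ∀ {x} → x < 0# → Positive (- x)
  x<0⇒0<-x {x} x<0 = <-respʳ (+-identityˡ (- x)) (x<y⇒0<y-x x<0)

  positive⇒# : ∀ {x} → Positive x → x # 0#
  positive⇒# 0<x = Equivalence.from #⇔<⊎> (inj₂ 0<x)

  #⇒unit : ∀ {x} → x # 0# → Units.Unit (RealField.commutativeRing R) x
  #⇒unit {x} x#0 = Units.unit-resp (RealField.commutativeRing R) (x-0≈x x) (#⇒invertible x#0)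

  *-#0ˡ : ∀ {x y} → x * y # 0# → x # 0#
  *-#0ˡ {x} {y} xy#0 with t , txy≈1 , _ ← #⇒unit xy#0 = invertibleˡ⇒# (t * y ,
    trans (*-congˡ (x-0≈x x)) (trans (solve 3 (λ t y x → t :* y :* x := t :* (x :* y)) refl t y x) txy≈1))

  sign : ∀ {x} → x # 0# → x < 0# ⊎ Positive x
  sign = Equivalence.to #⇔<⊎>

  positive-*⁻ˡ : ∀ {x y} → Positive (x * y) → Positive y → Positive x
  positive-*⁻ˡ {x} {y} 0<xy 0<y = [ negative , (λ 0<x → 0<x) ]′ (sign (*-#0ˡ (positive⇒# 0<xy)))
    where
    negative : x < 0# → Positive x
    negative x<0 = contradiction
      (<-respʳ (solve 2 (λ x y → x :* y :+ :- x :* y := 𝟘) refl x y)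
        (positive-+ 0<xy (positive⇒nonNegative (*-pos (x<0⇒0<-x x<0) 0<y))))
      nonNegative-0

  -- The assumption x * y < 0 makes both factors apart from 0, after which their signs can be
  -- decided.
  nonNegative-* : ∀ {x y} → NonNegative x → NonNegative y → NonNegative (x * y)
  nonNegative-* {x} {y} 0≤x 0≤y xy<0 = [ 0≤x , (λ 0<x → [ 0≤y , (λ 0<y →
    positive⇒nonNegative (*-pos 0<x 0<y) xy<0) ]′ (sign (*-#0ˡ (#-congʳ (*-comm x y) xy#0)))) ]′ (sign (*-#0ˡ xy#0))
    where
    xy#0 : x * y # 0#
    xy#0 = Equivalence.from #⇔<⊎> (inj₁ xy<0)

  square-positive : ∀ {x} → x # 0# → Positive (x * x)
  square-positive {x} x#0 with sign x#0
  ... | inj₁ x<0 = <-respʳ (solve 1 (λ x → :- x :* :- x := x :* x) refl x) (*-pos (x<0⇒0<-x x<0) (x<0⇒0<-x x<0))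
  ... | inj₂ 0<x = *-pos 0<x 0<x

  square-nonNegative : ∀ x → NonNegative (x * x)
  square-nonNegative x xx<0 =
    positive⇒nonNegative (square-positive (*-#0ˡ (Equivalence.from #⇔<⊎> (inj₁ xx<0)))) xx<0

  positive-inverse : ∀ {x} → Positive x → ∃[ t ] (Positive t × t * x ≈ 1#)
  positive-inverse 0<x with t , tx≈1 , _ ← #⇒unit (positive⇒# 0<x) =
    t , positive-*⁻ˡ (<-respʳ (sym tx≈1) 0<1) 0<x , tx≈1

  *-<-bound : ∀ {x y z} → NonNegative x → x < z → y < 1# → x * y < z
  *-<-bound {x} {y} {z} 0≤x x<z y<1 = 0<y-x⇒x<y (<-respʳ
    (solve 3 (λ x y z → (z :- x) :+ x :* (𝟙 :- y) := z :- x :* y) refl x y z)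
    (positive-+ (x<y⇒0<y-x x<z) (nonNegative-* 0≤x (positive⇒nonNegative (x<y⇒0<y-x y<1)))))

  nonNegative-·1 : ∀ n → NonNegative (n · 1#)
  nonNegative-·1 zero    = nonNegative-0
  nonNegative-·1 (suc n) = nonNegative-+ (positive⇒nonNegative 0<1) (nonNegative-·1 n)

  nonNegative-^ : ∀ {x} → NonNegative x → ∀ n → NonNegative (x ^ n)
  nonNegative-^ 0≤x zero    = positive⇒nonNegative 0<1
  nonNegative-^ 0≤x (suc n) = nonNegative-* 0≤x (nonNegative-^ 0≤x n)

  module _ {x} (0≤x : NonNegative x) (x<1 : x < 1#) where
    private
      0<1-x : Positive (1# - x)
      0<1-x = x<y⇒0<y-x x<1

      -- A form of Bernoulli's inequality that does not divide by x, which may be 0. From n to n + 1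
      -- the expression grows by xⁿ (n + 1) (1 - x)².
      bernoulli : ∀ n → NonNegative (1# - x ^ n * (1# + n · 1# * (1# - x)))
      bernoulli zero    = nonNegative-resp
        (solve 1 (λ x → 𝟘 := 𝟙 :- 𝟙 :* (𝟙 :+ 𝟘 :* (𝟙 :- x))) refl x) nonNegative-0
      bernoulli (suc n) = nonNegative-resp
        (solve 3 (λ x r m →
            (𝟙 :- r :* (𝟙 :+ m :* (𝟙 :- x))) :+ r :* ((𝟙 :+ m) :* ((𝟙 :- x) :* (𝟙 :- x)))
              := 𝟙 :- x :* r :* (𝟙 :+ (𝟙 :+ m) :* (𝟙 :- x)))
          refl x (x ^ n) (n · 1#))
        (nonNegative-+ (bernoulli n) (nonNegative-* (nonNegative-^ 0≤x n)
          (nonNegative-* (nonNegative-·1 (suc n)) (square-nonNegative (1# - x)))))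

    -- N exceeds t = 1 / (ε (1 - x)). For n ≥ N this gives ε (1 + n (1 - x)) > 1 ≥ xⁿ (1 + n (1 -
    -- x)), and the common positive factor is cancelled.
    ^-vanishes : ∀ ε → Positive ε → ∃[ N ] (∀ n → N ℕ.≤ n → x ^ n < ε)
    ^-vanishes ε 0<ε = N , λ n N≤n → below n (ℕ.m≤n⇒∃[o]m+o≡n N≤n)
      where
      inverse : ∃[ t ] (Positive t × t * (ε * (1# - x)) ≈ 1#)
      inverse = positive-inverse (*-pos 0<ε 0<1-x)

      t : Carrier
      t = proj₁ inverse

      t*ε[1-x]≈1 : t * (ε * (1# - x)) ≈ 1#
      t*ε[1-x]≈1 = proj₂ (proj₂ inverse)

      N : ℕ
      N = proj₁ (archimedean t)

      t<N : t < N · 1#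
      t<N = proj₂ (archimedean t)

      1<N*ε[1-x] : Positive (N · 1# * (ε * (1# - x)) - 1#)
      1<N*ε[1-x] = <-respʳ
        (trans (solve 3 (λ N t y → (N :- t) :* y := N :* y :- t :* y) refl (N · 1#) t (ε * (1# - x))) (+-congˡ (-‿cong t*ε[1-x]≈1)))
        (*-pos (x<y⇒0<y-x t<N) (*-pos 0<ε 0<1-x))

      below : ∀ n → ∃[ k ] (N ℕ.+ k ≡ n) → x ^ n < ε
      below n (k , ≡.refl) = 0<y-x⇒x<y (positive-*⁻ˡ
        (<-respʳ
          (trans
            (solve 6 (λ N k ε x r m →
                (ε :+ k :* (ε :* (𝟙 :- x)) :+ (N :* (ε :* (𝟙 :- x)) :- 𝟙)) :+ (𝟙 :- r :* (𝟙 :+ m :* (𝟙 :- x)))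
                  := ε :* (𝟙 :+ (N :+ k) :* (𝟙 :- x)) :- r :* (𝟙 :+ m :* (𝟙 :- x)))
              refl (N · 1#) (k · 1#) ε x (x ^ n) (n · 1#))
            (trans
              (+-congʳ (*-congˡ (+-congˡ (*-congʳ (sym (×-homo-+ 1# N k))))))
              (solve 3 (λ ε r y → ε :* y :- r :* y := (ε :- r) :* y) refl ε (x ^ n) (1# + n · 1# * (1# - x)))))
          (positive-+
            (positive-+ (positive-+ 0<ε (nonNegative-* (nonNegative-·1 k) (positive⇒nonNegative (*-pos 0<ε 0<1-x))))
              (positive⇒nonNegative 1<N*ε[1-x]))
            (bernoulli n)))
        (positive-+ 0<1 (nonNegative-* (nonNegative-·1 n) (positive⇒nonNegative 0<1-x))))

-- Complex numbers

module ComplexNumbers {c ℓ₁ ℓ₂ ℓ₃} (R : RealField c ℓ₁ ℓ₂ ℓ₃) where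
  open OrderedField R
  private
    module R where
      open CommutativeRing (RealField.commutativeRing R) public
      open IntegerSolver (RealField.commutativeRing R) public
    open R using (solve; _:=_; _:+_; _:*_; _:-_; :-_; 𝟘; 𝟙)
    module Cᴿ = RawRing (ℂ R)

  complexField : CommutativeRing c ℓ₁
  complexField = record
    { Carrier = Cᴿ.Carrier
    ; _≈_ = Cᴿ._≈_
    ; _+_ = Cᴿ._+_
    ; _*_ = Cᴿ._*_
    ; -_  = λ z → Cᴿ.- z
    ; 0#  = Cᴿ.0#
    ; 1#  = Cᴿ.1#
    ; isCommutativeRing = record
      { isRing = record
        { +-isAbelianGroup = record
          { isGroup = record
            { isMonoid = record
              { isSemigroup = record
                { isMagma = record
                  { isEquivalence = record
                    { refl  = R.refl , R.refl
                    ; sym   = λ (p , q) → R.sym p , R.sym q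
                    ; trans = λ (p , q) (p′ , q′) → R.trans p p′ , R.trans q q′
                    }
                  ; ∙-cong = λ (p , q) (p′ , q′) → R.+-cong p p′ , R.+-cong q q′
                  }
                ; assoc = λ (x , y) (x′ , y′) (x″ , y″) → R.+-assoc x x′ x″ , R.+-assoc y y′ y″
                }
              ; identity = (λ (x , y) → R.+-identityˡ x , R.+-identityˡ y)
                         , (λ (x , y) → R.+-identityʳ x , R.+-identityʳ y)
              }
            ; inverse = (λ (x , y) → R.-‿inverseˡ x , R.-‿inverseˡ y)
                      , (λ (x , y) → R.-‿inverseʳ x , R.-‿inverseʳ y)
            ; ⁻¹-cong = λ (p , q) → R.-‿cong p , R.-‿cong q
            }
          ; comm = λ (x , y) (x′ , y′) → R.+-comm x x′ , R.+-comm y y′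
          }
        ; *-cong = λ (p , q) (p′ , q′) →
            R.+-cong (R.*-cong p p′) (R.-‿cong (R.*-cong q q′)) ,
            R.+-cong (R.*-cong p q′) (R.*-cong q p′)
        ; *-assoc = λ (x , y) (x′ , y′) (x″ , y″) →
            solve 6 (λ x y x′ y′ x″ y″ → (x :* x′ :- y :* y′) :* x″ :- (x :* y′ :+ y :* x′) :* y″
              := x :* (x′ :* x″ :- y′ :* y″) :- y :* (x′ :* y″ :+ y′ :* x″)) R.refl x y x′ y′ x″ y″ ,
            solve 6 (λ x y x′ y′ x″ y″ → (x :* x′ :- y :* y′) :* y″ :+ (x :* y′ :+ y :* x′) :* x″
              := x :* (x′ :* y″ :+ y′ :* x″) :+ y :* (x′ :* x″ :- y′ :* y″)) R.refl x y x′ y′ x″ y″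
        ; *-identity =
            (λ (x , y) → solve 2 (λ x y → 𝟙 :* x :- 𝟘 :* y := x) R.refl x y ,
                         solve 2 (λ x y → 𝟙 :* y :+ 𝟘 :* x := y) R.refl x y) ,
            (λ (x , y) → solve 2 (λ x y → x :* 𝟙 :- y :* 𝟘 := x) R.refl x y ,
                         solve 2 (λ x y → x :* 𝟘 :+ y :* 𝟙 := y) R.refl x y)
        ; distrib =
            (λ (x , y) (x′ , y′) (x″ , y″) →
              solve 6 (λ x y x′ y′ x″ y″ → x :* (x′ :+ x″) :- y :* (y′ :+ y″)
                := (x :* x′ :- y :* y′) :+ (x :* x″ :- y :* y″)) R.refl x y x′ y′ x″ y″ ,
              solve 6 (λ x y x′ y′ x″ y″ → x :* (y′ :+ y″) :+ y :* (x′ :+ x″)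
                := (x :* y′ :+ y :* x′) :+ (x :* y″ :+ y :* x″)) R.refl x y x′ y′ x″ y″) ,
            (λ (x , y) (x′ , y′) (x″ , y″) →
              solve 6 (λ x y x′ y′ x″ y″ → (x′ :+ x″) :* x :- (y′ :+ y″) :* y
                := (x′ :* x :- y′ :* y) :+ (x″ :* x :- y″ :* y)) R.refl x y x′ y′ x″ y″ ,
              solve 6 (λ x y x′ y′ x″ y″ → (x′ :+ x″) :* y :+ (y′ :+ y″) :* x
                := (x′ :* y :+ y′ :* x) :+ (x″ :* y :+ y″ :* x)) R.refl x y x′ y′ x″ y″)
        }
      ; *-comm = λ (x , y) (x′ , y′) →
          solve 4 (λ x y x′ y′ → x :* x′ :- y :* y′ := x′ :* x :- y′ :* y) R.refl x y x′ y′ ,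
          solve 4 (λ x y x′ y′ → x :* y′ :+ y :* x′ := x′ :* y :+ y′ :* x) R.refl x y x′ y′
      }
    }

  open CommutativeRing complexField hiding (zero)
  open import Algebra.Definitions.RawSemiring (RawRing.rawSemiring rawRing) using (_^_)
  open Units complexField

  -- ∣ z ∣²
  norm : Carrier → R.Carrier
  norm (x , y) = x R.* x R.+ y R.* y

  norm-cong : ∀ {z w} → z ≈ w → norm z R.≈ norm w
  norm-cong (p , q) = R.+-cong (R.*-cong p p) (R.*-cong q q)

  norm-nonNegative : ∀ z → NonNegative (norm z)
  norm-nonNegative (x , y) = nonNegative-+ (square-nonNegative x) (square-nonNegative y)

  norm-* : ∀ z w → norm (z * w) R.≈ norm z R.* norm w
  norm-* (x , y) (x′ , y′) = solve 4 (λ x y x′ y′ →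
    (x :* x′ :- y :* y′) :* (x :* x′ :- y :* y′) :+ (x :* y′ :+ y :* x′) :* (x :* y′ :+ y :* x′)
      := (x :* x :+ y :* y) :* (x′ :* x′ :+ y′ :* y′)) R.refl x y x′ y′

  norm-neg : ∀ z → norm (- z) R.≈ norm z
  norm-neg (x , y) = solve 2 (λ x y → :- x :* :- x :+ :- y :* :- y := x :* x :+ y :* y) R.refl x y

  norm-1 : norm 1# R.≈ R.1#
  norm-1 = solve 0 (𝟙 :* 𝟙 :+ 𝟘 :* 𝟘 := 𝟙) R.refl

  norm-^ : ∀ z n → norm (z ^ n) R.≈ RealField._^_ R (norm z) n
  norm-^ z zero    = norm-1
  norm-^ z (suc n) = R.trans (norm-* z (z ^ n)) (R.*-congˡ (norm-^ z n))

  -- Dropping the nonnegative `norm (z - w)` leaves ∣ z + w ∣² ≤ 2 ∣ z ∣² + 2 ∣ w ∣².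
  parallelogram : ∀ z w → norm (z + w) R.+ norm (z - w) R.≈ (norm z R.+ norm z) R.+ (norm w R.+ norm w)
  parallelogram (x , y) (x′ , y′) = solve 4 (λ x y x′ y′ →
    ((x :+ x′) :* (x :+ x′) :+ (y :+ y′) :* (y :+ y′)) :+ ((x :- x′) :* (x :- x′) :+ (y :- y′) :* (y :- y′))
      := ((x :* x :+ y :* y) :+ (x :* x :+ y :* y)) :+ ((x′ :* x′ :+ y′ :* y′) :+ (x′ :* x′ :+ y′ :* y′)))
    R.refl x y x′ y′

  -- The inverse is the conjugate divided by ∣ z ∣².
  norm-positive⇒unit : ∀ z → Positive (norm z) → Unit z
  norm-positive⇒unit (x , y) 0<∣z∣² = invertibleˡ⇒invertible ((t R.* x , R.- (t R.* y)) ,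
    R.trans (solve 3 (λ t x y → t :* x :* x :- :- (t :* y) :* y := t :* (x :* x :+ y :* y)) R.refl t x y)
      (proj₂ (proj₂ inverse)) ,
    solve 3 (λ t x y → t :* x :* y :+ :- (t :* y) :* x := 𝟘) R.refl t x y)
    where
    inverse : ∃[ t ] (Positive t × t R.* norm (x , y) R.≈ R.1#)
    inverse = positive-inverse 0<∣z∣²

    t : R.Carrier
    t = proj₁ inverse

  -- (1 - x) (1 + x) = (1 - ∣ z ∣²) + y² is positive for z = x + i y.
  1-z-unit : ∀ z → norm z < R.1# → Unit (1# - z)
  1-z-unit (x , y) ∣z∣²<1 = norm-positive⇒unit (1# - (x , y)) (positive-+
    (square-positive (*-#0ˡ {R.1# R.- x} {R.1# R.+ x} (positive⇒# (<-respʳ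
      (solve 2 (λ x y → 𝟙 :- (x :* x :+ y :* y) :+ y :* y := (𝟙 :- x) :* (𝟙 :+ x)) R.refl x y)
      (positive-+ (x<y⇒0<y-x ∣z∣²<1) (square-nonNegative y))))))
    (square-nonNegative (R.0# R.- y)))

  -- Bounds ∣ s n ∣² by ε itself. The squared bound demanded by `_⟶_` is recovered by taking ε² for
  -- ε.
  Null : (ℕ → Carrier) → Set _
  Null s = ∀ ε → Positive ε → ∃[ N ] (∀ n → N ≤ n → norm (s n) < ε)

  null-cong : ∀ {s t} → (∀ n → s n ≈ t n) → Null s → Null t
  null-cong s≈t null ε 0<ε with N , below ← null ε 0<ε =
    N , λ n N≤n → <-respˡ (norm-cong (s≈t n)) (below n N≤n)

  null-neg : ∀ {s} → Null s → Null (λ n → - s n)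
  null-neg {s} null ε 0<ε with N , below ← null ε 0<ε =
    N , λ n N≤n → <-respˡ (R.sym (norm-neg (s n))) (below n N≤n)

  null-+ : ∀ {s t} → Null s → Null t → Null (λ n → s n + t n)
  null-+ {s} {t} s-null t-null ε 0<ε = N₁ ⊔ N₂ , below
    where
    4# : R.Carrier
    4# = (R.1# R.+ R.1#) R.+ (R.1# R.+ R.1#)

    0<4 : Positive 4#
    0<4 = positive-+ 0<2 (positive⇒nonNegative 0<2)
      where 0<2 = positive-+ 0<1 (positive⇒nonNegative 0<1)

    quarter : ∃[ r ] (Positive r × r R.* 4# R.≈ R.1#)
    quarter = positive-inverse 0<4

    -- δ = ε / 4, since the bound from the parallelogram law is 2 δ + 2 δ.
    δ : R.Carrier
    δ = proj₁ quarter R.* ε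

    4δ≈ε : (δ R.+ δ) R.+ (δ R.+ δ) R.≈ ε
    4δ≈ε = R.trans
      (solve 2 (λ r ε → (r :* ε :+ r :* ε) :+ (r :* ε :+ r :* ε) := r :* ((𝟙 :+ 𝟙) :+ (𝟙 :+ 𝟙)) :* ε)
        R.refl (proj₁ quarter) ε)
      (R.trans (R.*-congʳ (proj₂ (proj₂ quarter))) (R.*-identityˡ ε))

    0<δ : Positive δ
    0<δ = *-pos (proj₁ (proj₂ quarter)) 0<ε

    N₁ N₂ : ℕ
    N₁ = proj₁ (s-null δ 0<δ)
    N₂ = proj₁ (t-null δ 0<δ)

    below : ∀ n → N₁ ⊔ N₂ ≤ n → norm (s n + t n) < ε
    below n N≤n = 0<y-x⇒x<y (<-respʳ
      (begin
        ((δ R.- a) R.+ (δ R.- a)) R.+ ((δ R.- b) R.+ (δ R.- b)) R.+ norm (s n - t n)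
          ≈⟨ solve 4 (λ δ a b m → ((δ :- a) :+ (δ :- a)) :+ ((δ :- b) :+ (δ :- b)) :+ m
               := (δ :+ δ) :+ (δ :+ δ) :- ((a :+ a) :+ (b :+ b)) :+ m) R.refl δ a b (norm (s n - t n)) ⟩
        (δ R.+ δ) R.+ (δ R.+ δ) R.- ((a R.+ a) R.+ (b R.+ b)) R.+ norm (s n - t n)
          ≈⟨ R.+-congʳ (R.+-cong 4δ≈ε (R.-‿cong (R.sym (parallelogram (s n) (t n))))) ⟩
        ε R.- (norm (s n + t n) R.+ norm (s n - t n)) R.+ norm (s n - t n)
          ≈⟨ solve 3 (λ ε l m → ε :- (l :+ m) :+ m := ε :- l) R.refl ε (norm (s n + t n)) (norm (s n - t n)) ⟩
        ε R.- norm (s n + t n)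
          ∎)
      (positive-+ (positive-+ (positive-+ 0<δ-a (positive⇒nonNegative 0<δ-a))
        (positive⇒nonNegative (positive-+ 0<δ-b (positive⇒nonNegative 0<δ-b))))
        (norm-nonNegative (s n - t n))))
      where
      open SetoidReasoning R.setoid
      a = norm (s n)
      b = norm (t n)

      0<δ-a : Positive (δ R.- a)
      0<δ-a = x<y⇒0<y-x (proj₂ (s-null δ 0<δ) n (ℕ.≤-trans (ℕ.m≤m⊔n N₁ N₂) N≤n))

      0<δ-b : Positive (δ R.- b)
      0<δ-b = x<y⇒0<y-x (proj₂ (t-null δ 0<δ) n (ℕ.≤-trans (ℕ.m≤n⊔m N₁ N₂) N≤n))

  null-* : ∀ {s t} → Null s → Null t → Null (λ n → s n * t n)
  -- As `norm` is multiplicative, it suffices that t eventually has norm below 1.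
  null-* {s} {t} s-null t-null ε 0<ε with N₁ , s-below ← s-null ε 0<ε | N₂ , t-below ← t-null R.1# 0<1 =
    N₁ ⊔ N₂ , λ n N≤n → <-respˡ (R.sym (norm-* (s n) (t n)))
      (*-<-bound (norm-nonNegative (s n))
        (s-below n (ℕ.≤-trans (ℕ.m≤m⊔n N₁ N₂) N≤n))
        (t-below n (ℕ.≤-trans (ℕ.m≤n⊔m N₁ N₂) N≤n)))

  null-scale : ∀ {s} z → Null s → Null (λ n → z * s n)
  null-scale {s} z null ε 0<ε = proj₁ (null δ 0<δ) , λ n N≤n → 0<y-x⇒x<y (<-respʳ
    (begin
      (R.1# R.+ norm z) R.* (δ R.- norm (s n)) R.+ norm (s n)
        ≈⟨ solve 4 (λ m a r ε → (𝟙 :+ m) :* (r :* ε :- a) :+ a := r :* (𝟙 :+ m) :* ε :- m :* a)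
             R.refl (norm z) (norm (s n)) (proj₁ inverse) ε ⟩
      proj₁ inverse R.* (R.1# R.+ norm z) R.* ε R.- norm z R.* norm (s n)
        ≈⟨ R.+-cong (R.trans (R.*-congʳ (proj₂ (proj₂ inverse))) (R.*-identityˡ ε)) (R.-‿cong (R.sym (norm-* z (s n)))) ⟩
      ε R.- norm (z * s n)
        ∎)
    (positive-+ (*-pos 0<1+∣z∣² (x<y⇒0<y-x (proj₂ (null δ 0<δ) n N≤n))) (norm-nonNegative (s n))))
    where
    open SetoidReasoning R.setoid

    0<1+∣z∣² : Positive (R.1# R.+ norm z)
    0<1+∣z∣² = positive-+ 0<1 (norm-nonNegative z)

    inverse : ∃[ r ] (Positive r × r R.* (R.1# R.+ norm z) R.≈ R.1#)
    inverse = positive-inverse 0<1+∣z∣²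

    -- δ = ε / (1 + ∣ z ∣²); the summand 1 keeps the denominator positive even for z = 0.
    δ : R.Carrier
    δ = proj₁ inverse R.* ε

    0<δ : Positive δ
    0<δ = *-pos (proj₁ (proj₂ inverse)) 0<ε

  null⇒⟶ : ∀ s z → Null (λ n → s n - z) → _⟶_ R s z
  null⇒⟶ s z null ε 0<ε with N , below ← null (ε R.* ε) (*-pos 0<ε 0<ε) = N , λ n N≤n → 0<ε , below n N≤n

  module _ (q : Carrier) (∣q∣²<1 : norm q < R.1#) where
    open QBinomial complexField using (shiftedFactorial; shiftedFactorial-last; geometric; geometric-inverseˡ; geometric-inverseʳ; ∏-geometric-coefficient; 1-q^)
    open Generating R rawRing (real R) q
    open QCounting commutativeSemiring q using (⟨_⟩; ⟨_⟩!)

    1-q-unit : Unit (1# - q)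
    1-q-unit = 1-z-unit q ∣q∣²<1

    norm-q^ : ∀ n → norm (q ^ suc n) < R.1#
    norm-q^ zero    = <-respˡ (R.sym (norm-cong (*-identityʳ q))) ∣q∣²<1
    norm-q^ (suc n) = <-respˡ (R.sym (norm-* q (q ^ suc n)))
      (*-<-bound (norm-nonNegative q) ∣q∣²<1 (norm-q^ n))

    -- A factor of the unit 1 - qⁿ⁺¹ = (1 - q) [n + 1].
    ⟨⟩-unit : ∀ n → Unit ⟨ suc n ⟩
    ⟨⟩-unit n = unit-*⁻ʳ (unit-resp (1-q^ q (suc n)) (1-z-unit (q ^ suc n) (norm-q^ n)))

    factorialsInvertible : FactorialsInvertible
    factorialsInvertible n = unit-product {n} λ i → unit-resp (sym (sum-q^ complexField q (suc (toℕ i)))) (⟨⟩-unit (toℕ i))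

    factorsInvertible : ∀ {a} (p : Vector R.Carrier a) → FactorsInvertible p
    factorsInvertible p i j = geometric x , geometric-inverseˡ x , geometric-inverseʳ x
      where x = real R (p i) * (1# - q) * q ^ j

    null-q^ : ∀ m → Null (λ n → q ^ (n ℕ.+ m))
    null-q^ m ε 0<ε = proj₁ vanishes , λ n N≤n → <-respˡ (R.sym (norm-^ q (n ℕ.+ m)))
      (proj₂ vanishes (n ℕ.+ m) (ℕ.≤-trans N≤n (ℕ.m≤m+n n m)))
      where
      vanishes : ∃[ N ] (∀ n → N ≤ n → RealField._^_ R (norm q) n < ε)
      vanishes = ^-vanishes (norm-nonNegative q) ∣q∣²<1 ε 0<ε

    null-shiftedFactorial : ∀ n → Null (λ J → shiftedFactorial q J n - 1#)
    null-shiftedFactorial zero    = null-cong {λ _ → 0#} (λ _ → sym (-‿inverseʳ 1#))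
      λ ε 0<ε → 0 , λ _ _ → <-respˡ (solve 0 (𝟘 := 𝟘 :* 𝟘 :+ 𝟘 :* 𝟘) R.refl) 0<ε
    null-shiftedFactorial (suc n) = null-cong step
      (null-+ {λ J → d J} (null-shiftedFactorial n)
        (null-neg {λ J → d J * e J + e J} (null-+ {λ J → d J * e J} {e} (null-* {d} {e} (null-shiftedFactorial n) (null-q^ n)) (null-q^ n))))
      where
      d e : ℕ → Carrier
      d J = shiftedFactorial q J n - 1#
      e J = q ^ (J ℕ.+ n)

      -- This is (1 + d) (1 - e) - 1 = d - (d e + e), where 1 - e is the last factor.
      step : ∀ J → d J - (d J * e J + e J) ≈ shiftedFactorial q J (suc n) - 1#
      step J = trans
        (C.solve 2 (λ s e → (s C.:- C.𝟙) C.:- ((s C.:- C.𝟙) C.:* e C.:+ e) C.:= s C.:* (C.𝟙 C.:- e) C.:- C.𝟙)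
          refl (shiftedFactorial q J n) (e J))
        (+-congʳ (sym (shiftedFactorial-last q J n)))
        where module C = IntegerSolver complexField

    -- By `∏-geometric-coefficient` the error in the n-th coefficient is y ((qᴶ; q)ₙ - 1), with y
    -- the n-th coefficient of the q-exponential.
    partialProduct⟶qExponential : ∀ {a} (p : Vector R.Carrier a) i →
      CoefficientwiseLimit R (partialProduct (factorsInvertible p) i) (qExponential factorialsInvertible (p i))
    partialProduct⟶qExponential p i n = null⇒⟶ (λ J → partialProduct (factorsInvertible p) i J n) y
      (null-cong
        (λ J → trans (C.solve 2 (λ y s → y C.:* (s C.:- C.𝟙) C.:= y C.:* s C.:- y) refl y (shiftedFactorial q J n))
          (+-congʳ (sym (∏-geometric-coefficient q 1-q-unit J n (real R (p i)) e e*n!≈1))))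
        (null-scale {λ J → shiftedFactorial q J n - 1#} y (null-shiftedFactorial n)))
      where
      module C = IntegerSolver complexField
      e = proj₁ (factorialsInvertible n)
      y = real R (p i) ^ n * e

      e*n!≈1 : e * ⟨ n ⟩! ≈ 1#
      e*n!≈1 = trans (*-congˡ (sym (product-sum-q^ complexField q n))) (proj₁ (proj₂ (factorialsInvertible n)))

-- The two equalities over ℝ(q) and ℂ

module _ {c ℓ₁ ℓ₂ ℓ₃} (R : RealField c ℓ₁ ℓ₂ ℓ₃) {a} (p : Vector (RealField.Carrier R) a) where

  module _ where
    open Generating R (ℝ⟨q⟩ R) (constant R) (indeterminate R)
    open RationalFunctions R
    open PolynomialFractions R

    inversionSeries-product : Σ[ 1/! ∈ FactorialsInvertible ]
      inversionSeries 1/! p ≈ₛ ∏ₛ (λ i → qExponential 1/! (p i))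
    inversionSeries-product = factorialsInvertible
      , inversionSeries≈∏qExponential R rationalFunctionField (constant R) constant-isHomomorphism
          (indeterminate R) p factorialsInvertible

  module _ (q : RawRing.Carrier (ℂ R)) (∣q∣<1 : ∣_∣<_ R q (RealField.1# R)) where
    open Generating R (ℂ R) (real R) q
    open ComplexNumbers R

    ∣q∣²<1 : RealField._<_ R (norm q) (RealField.1# R)
    -- The hypothesis bounds ∣ q ∣² by the square 1 * 1.
    ∣q∣²<1 = OrderedField.<-respʳ R (CommutativeRing.*-identityˡ (RealField.commutativeRing R) (RealField.1# R)) (proj₂ ∣q∣<1)

    partialProducts-converge : Σ[ 1/! ∈ FactorialsInvertible ]
      Σ[ 1/factor ∈ FactorsInvertible p ]
      Σ[ F ∈ Vector (PowerSeries (ℂ R)) a ]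
        (∀ i → CoefficientwiseLimit R (partialProduct 1/factor i) (F i))
        × ∏ₛ (λ i → qExponential 1/! (p i)) ≈ₛ ∏ₛ F
    partialProducts-converge = factorialsInvertible q ∣q∣²<1
      , factorsInvertible q ∣q∣²<1 p
      -- The limits are the q-exponentials themselves, so the content lies in the convergence and
      -- the two products agree by reflexivity.
      , (λ i → qExponential (factorialsInvertible q ∣q∣²<1) (p i))
      , partialProduct⟶qExponential q ∣q∣²<1 p
      , λ n → CommutativeRing.refl complexField

theorem5 : ∀ {c ℓ₁ ℓ₂ ℓ₃} (R : RealField c ℓ₁ ℓ₂ ℓ₃) →
    (a : ℕ) → 1 ≤ a →
    (p : Vector (RealField.Carrier R) a) → IsProbabilityVector R p →
    (let open Generating R (ℝ⟨q⟩ R) (constant R) (indeterminate R) in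
    Σ[ 1/! ∈ FactorialsInvertible ]
    inversionSeries 1/! p ≈ₛ ∏ₛ (λ i → qExponential 1/! (p i)))
    ×
    ((q : RawRing.Carrier (ℂ R)) → ∣_∣<_ R q (RealField.1# R) →
    let open Generating R (ℂ R) (real R) q in
    Σ[ 1/! ∈ FactorialsInvertible ]
    Σ[ 1/factor ∈ FactorsInvertible p ]
    Σ[ F ∈ Vector (PowerSeries (ℂ R)) a ]
    (∀ i → CoefficientwiseLimit R (partialProduct 1/factor i) (F i))
    × ∏ₛ (λ i → qExponential 1/! (p i)) ≈ₛ ∏ₛ F)
theorem5 R a _ p _ = inversionSeries-product R p , partialProducts-converge R p
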